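{- If $p$, $q$ and $r$ are distinct primes, then every skew morphism of the cyclic group $\mathrm{C}_{pqr}$ is coset-preserving.
   Context: For a finite group $B$, a skew morphism of $B$ is a permutation $\varphi$ of $B$ fixing the identity such that for every $a\in B$ there is a positive integer $i_a$ with $\varphi(ab)=\varphi(a)\varphi^{i_a}(b)$ for all $b\in B$. Its order $\mathrm{ord}(\varphi)$ is the order of $\langle\varphi\rangle$. The power function $\pi$ maps $a$ to the unique such $i_a\in\{1,\dots,\mathrm{ord}(\varphi)\}$ (with $\pi\equiv1$ for the identity). $\varphi$ is coset-preserving if $\pi(\varphi(a))=\pi(a)$ for all $a\in B$. -}

module Defs where

open import Data.Nat using (ℕ; zero; suc; _≤_; _<_; NonZero)
open import Data.Nat.DivMod using (_mod_)
open import Data.Fin using (Fin; toℕ)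
open import Data.Product using (Σ; _×_; ∃)
open import Function.Definitions using (Bijective)
open import Relation.Binary.PropositionalEquality using (_≡_)
import Data.Nat as ℕ

module Cyclic (n : ℕ) .{{_ : NonZero n}} where

  C : Set
  C = Fin n

  e : C
  e = 0 mod n

  _⊕_ : C → C → C
  a ⊕ b = (toℕ a ℕ.+ toℕ b) mod n

  iter : (C → C) → ℕ → C → C
  iter φ zero    x = x
  iter φ (suc i) x = φ (iter φ i x)

  record IsSkewMorphism (φ : C → C) : Set where
    field
      bijective : Bijective _≡_ _≡_ φ
      fixes-e   : φ e ≡ e
      skew      : ∀ a → Σ ℕ λ i → (1 ≤ i) × (∀ b → φ (a ⊕ b) ≡ φ a ⊕ iter φ i b)

  IsOrder : (C → C) → ℕ → Set
  IsOrder φ k = (1 ≤ k) × (∀ x → iter φ k x ≡ x)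
              × (∀ j → 1 ≤ j → j < k → ¬Id j)
    where
      ¬Id : ℕ → Set
      ¬Id j = (∀ x → iter φ j x ≡ x) → Data.Empty.⊥
        where import Data.Empty

  -- π(a) = i, where k = ord(φ): i is the (unique) element of {1,…,k}
  -- with φ(a ⊕ b) = φ(a) ⊕ φ^i(b) for all b.
  PowerFunctionValue : (C → C) → (k : ℕ) → C → ℕ → Set
  PowerFunctionValue φ k a i =
    (1 ≤ i) × (i ≤ k) × (∀ b → φ (a ⊕ b) ≡ φ a ⊕ iter φ i b)

  IsCosetPreserving : (C → C) → Set
  IsCosetPreserving φ = ∀ k → IsOrder φ k → ∀ a i →
    PowerFunctionValue φ k a i → PowerFunctionValue φ k (φ a) i

{-# OPTIONS --safe #-}
module Submission where

-- Let G be the group of permutations of the cyclic group C generated by φ and the translations. As a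
-- product of two abelian groups, G has abelian derived group T (Itô). The T-orbit of e is a subgroup of
-- C containing all φ(a) − a, so φ is coset-preserving once this orbit lies in the kernel of φ.
--
-- Let s be a prime with n = s N, s ∤ N, and let c of order s lie in the orbit. The orbit of e under the
-- s-primary part S of T consists exactly of the v with s v = e: averaging over the coprime part of T, or
-- of a translation, would otherwise give a nontrivial translation with a fixed point. Hence S acts on
-- the cosets of ⟨c⟩ by translations; φ normalises S, so it permutes these cosets and is affine on each.
--
-- Consequently y ↦ φ(c + φ⁻¹ y) − φ c is a power of φ of the form y ↦ y + f(y), where f is constant on the
-- cosets of ⟨c⟩, takes values in ⟨c⟩ and vanishes at e. The sum F of f over a transversal of ⟨c⟩ is fixed
-- by all linear parts of φ. If F ≠ 0, these linear parts are trivial, whence f = 0. If F = 0, then in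
-- f(1 + x) = f(1) + a f(x) (translates of f are affine in f, as ⟨φ⟩ has only one subgroup of order s),
-- summation gives N f(1) = 0, so f(1) = 0 and again f = 0. Therefore c lies in the kernel.

open import Defs
open import Algebra.Bundles using (AbelianGroup)
open import Data.Empty using (⊥; ⊥-elim)
open import Data.Fin using (Fin; toℕ)
import Data.Fin as Fin
open import Data.Fin.Permutation
  using (Permutation′; permutation; _⟨$⟩ʳ_; _⟨$⟩ˡ_; inverseˡ; inverseʳ; id; flip)
open import Data.Fin.Properties using (_≟_; pigeonhole; toℕ-fromℕ<; toℕ-injective; toℕ<n)
open import Data.Nat
  using (ℕ; zero; suc; _+_; _*_; _∸_; _≤_; _<_; z≤n; s≤s; s≤s⁻¹; NonZero; _%_; _/_; _!; >-nonZero; >-nonZero⁻¹;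
         nonTrivial⇒n>1)
import Data.Nat as ℕ
open import Data.Nat.Coprimality using (Coprime; coprime-divisor; coprime⇒gcd≡1) renaming (sym to coprime-sym)
open import Data.Nat.DivMod
open import Data.Nat.Divisibility
open import Data.Nat.GCD using (gcd; gcd-GCD; gcd[m,n]∣m; gcd-greatest; c*gcd[m,n]≡gcd[cm,cn]; gcd[m,n]∣n; module Bézout)
open import Data.Nat.Induction using (<-rec)
open import Data.Nat.Primality
  using (Prime; prime⇒nonZero; prime⇒nonTrivial; prime⇒irreducible; euclidsLemma; ¬prime[1])
open import Data.Nat.Properties hiding (_≟_)
open import Data.Product using (Σ; ∃; ∃₂; _×_; _,_; proj₁; proj₂)
open import Data.Sum using (_⊎_; inj₁; inj₂)
open import Function.Construct.Composition using (_↔-∘_)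
open import Level using (0ℓ)
open import Relation.Nullary using (¬_; Dec; yes; no)
open import Relation.Binary.PropositionalEquality
  using (_≡_; _≢_; refl; sym; trans; cong; cong₂; subst; isEquivalence; module ≡-Reasoning)

-- Bézout arguments on sets of natural numbers.

record IsIdeal (P : ℕ → Set) : Set where
  field
    add : ∀ {u v} → P u → P v → P (u + v)
    sub : ∀ {u v} → P (u + v) → P u → P v

  has-0 : ∀ {u} → P u → P 0
  has-0 {u} p = sub (subst P (sym (+-identityʳ u)) p) p

  mul : ∀ t {u} → P u → P (t * u)
  mul zero    p = has-0 p
  mul (suc t) p = add p (mul t p)

  -- Bézout over ℕ presents the gcd as a difference of multiples, and `sub` stands in for
  -- subtraction. Annihilators, periods, coboundaries and the kernel all descend from two numbers to
  -- their gcd in this way.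
  has-gcd : ∀ u v → P u → P v → P (gcd u v)
  has-gcd u v pu pv with Bézout.identity (gcd-GCD u v)
  ... | Bézout.Identity.+- x y eq =
    sub (subst P (trans (sym eq) (+-comm (gcd u v) (y * v))) (mul x pu)) (mul y pv)
  ... | Bézout.Identity.-+ x y eq =
    sub (subst P (trans (sym eq) (+-comm (gcd u v) (x * u))) (mul y pv)) (mul x pu)

  has-1 : ∀ {u v} → Coprime u v → P u → P v → P 1
  has-1 {u} {v} cop pu pv = subst P (coprime⇒gcd≡1 cop) (has-gcd u v pu pv)

-- The cyclic group of residues and its multiples.

module CyclicGroup (n : ℕ) .{{_ : NonZero n}} where
  open Cyclic n

  [_] : ℕ → C
  [ m ] = m mod n

  toℕ-[] : ∀ m → toℕ [ m ] ≡ m % n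
  toℕ-[] m = toℕ-fromℕ< (m%n<n m n)

  []-toℕ : ∀ a → [ toℕ a ] ≡ a
  []-toℕ a = toℕ-injective (trans (toℕ-[] (toℕ a)) (m<n⇒m%n≡m (toℕ<n a)))

  []-cong : ∀ {i j} → i % n ≡ j % n → [ i ] ≡ [ j ]
  []-cong {i} {j} eq = toℕ-injective (trans (toℕ-[] i) (trans eq (sym (toℕ-[] j))))

  []-+ : ∀ i j → [ i + j ] ≡ [ i ] ⊕ [ j ]
  []-+ i j = []-cong (trans (%-distribˡ-+ i j n)
    (cong (_% n) (sym (cong₂ _+_ (toℕ-[] i) (toℕ-[] j)))))

  []≡e⇒∣ : ∀ {i} → [ i ] ≡ e → n ∣ i
  []≡e⇒∣ {i} eq = m%n≡0⇒n∣m i n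
    (trans (sym (toℕ-[] i)) (trans (cong toℕ eq) (trans (toℕ-[] 0) (n∣m⇒m%n≡0 0 n (n ∣0)))))

  ∣⇒[]≡e : ∀ {i} → n ∣ i → [ i ] ≡ e
  ∣⇒[]≡e {i} n∣i = []-cong (trans (n∣m⇒m%n≡0 i n n∣i) (sym (n∣m⇒m%n≡0 0 n (n ∣0))))

  infix 22 ⊖_

  ⊖_ : C → C
  ⊖ a = [ n ∸ toℕ a ]

  ⊕-comm : ∀ a b → a ⊕ b ≡ b ⊕ a
  ⊕-comm a b = cong [_] (+-comm (toℕ a) (toℕ b))

  ⊕-assoc : ∀ a b c → (a ⊕ b) ⊕ c ≡ a ⊕ (b ⊕ c)
  ⊕-assoc a b c = begin
    (a ⊕ b) ⊕ c             ≡⟨ cong ((a ⊕ b) ⊕_) ([]-toℕ c) ⟨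
    [ i + j ] ⊕ [ k ]       ≡⟨ []-+ (i + j) k ⟨
    [ i + j + k ]           ≡⟨ cong [_] (+-assoc i j k) ⟩
    [ i + (j + k) ]         ≡⟨ []-+ i (j + k) ⟩
    [ i ] ⊕ (b ⊕ c)         ≡⟨ cong (_⊕ (b ⊕ c)) ([]-toℕ a) ⟩
    a ⊕ (b ⊕ c)             ∎
    where
    open ≡-Reasoning
    i = toℕ a
    j = toℕ b
    k = toℕ c

  ⊕-identityˡ : ∀ a → e ⊕ a ≡ a
  ⊕-identityˡ a = trans (cong (e ⊕_) (sym ([]-toℕ a))) (trans (sym ([]-+ 0 (toℕ a))) ([]-toℕ a))

  ⊕-inverseʳ : ∀ a → a ⊕ ⊖ a ≡ e
  ⊕-inverseʳ a = begin
    a ⊕ ⊖ a                        ≡⟨ cong (_⊕ ⊖ a) ([]-toℕ a) ⟨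
    [ toℕ a ] ⊕ [ n ∸ toℕ a ]        ≡⟨ []-+ (toℕ a) (n ∸ toℕ a) ⟨
    [ toℕ a + (n ∸ toℕ a) ]          ≡⟨ cong [_] (m+[n∸m]≡n (<⇒≤ (toℕ<n a))) ⟩
    [ n ]                            ≡⟨ ∣⇒[]≡e ∣-refl ⟩
    e                                ∎
    where open ≡-Reasoning

  ⊕-abelianGroup : AbelianGroup 0ℓ 0ℓ
  ⊕-abelianGroup = record
    { Carrier = C ; _≈_ = _≡_ ; _∙_ = _⊕_ ; ε = e ; _⁻¹ = ⊖_
    ; isAbelianGroup = record
      { isGroup = record
        { isMonoid = record
          { isSemigroup = record
            { isMagma = record { isEquivalence = isEquivalence ; ∙-cong = cong₂ _⊕_ }
            ; assoc = ⊕-assoc }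
          ; identity = ⊕-identityˡ , λ a → trans (⊕-comm a e) (⊕-identityˡ a) }
        ; inverse = (λ a → trans (⊕-comm (⊖ a) a) (⊕-inverseʳ a)) , ⊕-inverseʳ
        ; ⁻¹-cong = cong ⊖_ }
      ; comm = ⊕-comm } }

  open AbelianGroup ⊕-abelianGroup public using () renaming
    ( identityʳ to ⊕-identityʳ; inverseˡ to ⊕-inverseˡ; commutativeMonoid to ⊕-commutativeMonoid
    ; group to ⊕-group; monoid to ⊕-monoid)
  open import Algebra.Properties.Monoid.Mult ⊕-monoid public
    renaming (_×_ to infixr 21 _·_; ×-homo-+ to ·-homo-+; ×-assocˡ to ·-assocˡ)
    using ()
  open import Algebra.Properties.CommutativeMonoid.Mult ⊕-commutativeMonoid public
    renaming (×-distrib-+ to ·-distrib-⊕)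
    using ()

  ·-[] : ∀ i j → i · [ j ] ≡ [ i * j ]
  ·-[] zero    j = refl
  ·-[] (suc i) j = trans (cong ([ j ] ⊕_) (·-[] i j)) (sym ([]-+ j (i * j)))

  ·-e : ∀ i → i · e ≡ e
  ·-e i = trans (·-[] i 0) (cong [_] (*-zeroʳ i))

  ·-toℕ : ∀ i x → i · x ≡ [ i * toℕ x ]
  ·-toℕ i x = trans (cong (i ·_) (sym ([]-toℕ x))) (·-[] i (toℕ x))

  n·x≡e : ∀ x → n · x ≡ e
  n·x≡e x = trans (·-toℕ n x) (∣⇒[]≡e (m∣m*n (toℕ x)))

  ⊕-cancelˡ : ∀ a {b c} → a ⊕ b ≡ a ⊕ c → b ≡ c
  ⊕-cancelˡ a {b} {c} eq = begin
    b               ≡⟨ \\-leftDividesʳ a b ⟨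
    ⊖ a ⊕ (a ⊕ b) ≡⟨ cong (⊖ a ⊕_) eq ⟩
    ⊖ a ⊕ (a ⊕ c) ≡⟨ \\-leftDividesʳ a c ⟩
    c               ∎
    where
    open ≡-Reasoning
    open import Algebra.Properties.Group ⊕-group using (\\-leftDividesʳ)

  annihilator : ∀ x → IsIdeal (λ t → t · x ≡ e)
  annihilator x = record
    { add = λ {u} {v} p q → trans (·-homo-+ x u v) (trans (cong₂ _⊕_ p q) (⊕-identityˡ e))
    ; sub = λ {u} {v} p q → trans (sym (⊕-identityˡ (v · x)))
              (trans (cong (_⊕ v · x) (sym q)) (trans (sym (·-homo-+ x u v)) p)) }

  coprime-annihilators : ∀ {u v x} → Coprime u v → u · x ≡ e → v · x ≡ e → x ≡ e
  coprime-annihilators {x = x} cop p q =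
    trans (sym (⊕-identityʳ x)) (IsIdeal.has-1 (annihilator x) cop p q)

-- Conjugation and commutation of permutations.

module _ {n : ℕ} where

  ⟨$⟩ʳ-injective : (p : Permutation′ n) → ∀ {x y} → p ⟨$⟩ʳ x ≡ p ⟨$⟩ʳ y → x ≡ y
  ⟨$⟩ʳ-injective p eq = trans (sym (inverseˡ p)) (trans (cong (p ⟨$⟩ˡ_) eq) (inverseˡ p))

  Intertwines : (p g g′ : Permutation′ n) → Set
  Intertwines p g g′ = ∀ x → g′ ⟨$⟩ʳ (p ⟨$⟩ʳ x) ≡ p ⟨$⟩ʳ (g ⟨$⟩ʳ x)

  conjugate : (p g : Permutation′ n) → Permutation′ n
  conjugate p g = p ↔-∘ (g ↔-∘ flip p)

  conjugate-intertwines : ∀ p g → Intertwines p g (conjugate p g)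
  conjugate-intertwines p g x = cong (λ y → p ⟨$⟩ʳ (g ⟨$⟩ʳ y)) (inverseˡ p)

  intertwines-flip : ∀ p g g′ → Intertwines p g g′ → Intertwines p (flip g) (flip g′)
  intertwines-flip p g g′ h x = ⟨$⟩ʳ-injective g′
    (trans (inverseʳ g′) (sym (trans (h _) (cong (p ⟨$⟩ʳ_) (inverseʳ g)))))

  Commute : (g h : Permutation′ n) → Set
  Commute g h = ∀ x → g ⟨$⟩ʳ (h ⟨$⟩ʳ x) ≡ h ⟨$⟩ʳ (g ⟨$⟩ʳ x)

  commute-flip : ∀ g h → Commute g h → Commute g (flip h)
  commute-flip g h c x = ⟨$⟩ʳ-injective h
    (trans (sym (c _)) (trans (cong (g ⟨$⟩ʳ_) (inverseʳ h)) (sym (inverseʳ h))))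

-- Itô's theorem on products of two abelian groups.

module Commutators {n : ℕ} {I J : Set} (A : I → Permutation′ n) (B : J → Permutation′ n)
  (A-commute : ∀ i i′ → Commute (A i) (A i′))
  (B-commute : ∀ j j′ → Commute (B j) (B j′))
  (A-inverse : ∀ i → ∃ λ i′ → ∀ x → A i′ ⟨$⟩ʳ x ≡ A i ⟨$⟩ˡ x)
  (B-inverse : ∀ j → ∃ λ j′ → ∀ x → B j′ ⟨$⟩ʳ x ≡ B j ⟨$⟩ˡ x)
  (AB⊆BA : ∀ i j → ∃₂ λ j′ i′ → ∀ x → A i ⟨$⟩ʳ (B j ⟨$⟩ʳ x) ≡ B j′ ⟨$⟩ʳ (A i′ ⟨$⟩ʳ x))
  (BA⊆AB : ∀ j i → ∃₂ λ i′ j′ → ∀ x → B j ⟨$⟩ʳ (A i ⟨$⟩ʳ x) ≡ A i′ ⟨$⟩ʳ (B j′ ⟨$⟩ʳ x))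
  where

  -- The commutator of `A i` and `B j`, that is `A i` after `B j` after their inverses in the same
  -- order, with the inverses cleared.
  IsCommutator : I → J → Permutation′ n → Set
  IsCommutator i j g = ∀ x → g ⟨$⟩ʳ (B j ⟨$⟩ʳ (A i ⟨$⟩ʳ x)) ≡ A i ⟨$⟩ʳ (B j ⟨$⟩ʳ x)

  commutator-unique : ∀ {i j g g′} → IsCommutator i j g → IsCommutator i j g′ →
                      ∀ x → g ⟨$⟩ʳ x ≡ g′ ⟨$⟩ʳ x
  commutator-unique {i} {j} {g} {g′} c c′ x =
    subst (λ y → g ⟨$⟩ʳ y ≡ g′ ⟨$⟩ʳ y) eq (trans (c z) (sym (c′ z)))
    where
    z = A i ⟨$⟩ˡ (B j ⟨$⟩ˡ x)
    eq : B j ⟨$⟩ʳ (A i ⟨$⟩ʳ z) ≡ x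
    eq = trans (cong (B j ⟨$⟩ʳ_) (inverseʳ (A i))) (inverseʳ (B j))

  -- Let a₁ b = b′ a′. Conjugating the commutator of a and b by a₁ fixes a and turns b into b′ a′
  -- a₁⁻¹, whose last two factors commute with a. Only the `B`-index changes.
  commutator-conjugateᴬ : ∀ i₁ {i j g g′} → IsCommutator i j g → Intertwines (A i₁) g g′ →
                          IsCommutator i (proj₁ (AB⊆BA i₁ j)) g′
  commutator-conjugateᴬ i₁ {i} {j} {g} {g′} c t x = begin
    g′ ⟨$⟩ʳ (B j′ ⟨$⟩ʳ (A i ⟨$⟩ʳ x))             ≡⟨ cong (λ y → g′ ⟨$⟩ʳ (B j′ ⟨$⟩ʳ (A i ⟨$⟩ʳ y))) x≡ ⟩
    g′ ⟨$⟩ʳ (B j′ ⟨$⟩ʳ (A i ⟨$⟩ʳ (A i′ ⟨$⟩ʳ z))) ≡⟨ cong (λ y → g′ ⟨$⟩ʳ (B j′ ⟨$⟩ʳ y)) (A-commute i i′ z) ⟩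
    g′ ⟨$⟩ʳ (B j′ ⟨$⟩ʳ (A i′ ⟨$⟩ʳ (A i ⟨$⟩ʳ z))) ≡⟨ cong (g′ ⟨$⟩ʳ_) (sym (ex _)) ⟩
    g′ ⟨$⟩ʳ (A i₁ ⟨$⟩ʳ (B j ⟨$⟩ʳ (A i ⟨$⟩ʳ z)))  ≡⟨ t _ ⟩
    A i₁ ⟨$⟩ʳ (g ⟨$⟩ʳ (B j ⟨$⟩ʳ (A i ⟨$⟩ʳ z)))   ≡⟨ cong (A i₁ ⟨$⟩ʳ_) (c z) ⟩
    A i₁ ⟨$⟩ʳ (A i ⟨$⟩ʳ (B j ⟨$⟩ʳ z))            ≡⟨ A-commute i₁ i _ ⟩
    A i ⟨$⟩ʳ (A i₁ ⟨$⟩ʳ (B j ⟨$⟩ʳ z))            ≡⟨ cong (A i ⟨$⟩ʳ_) (ex z) ⟩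
    A i ⟨$⟩ʳ (B j′ ⟨$⟩ʳ (A i′ ⟨$⟩ʳ z))           ≡⟨ cong (λ y → A i ⟨$⟩ʳ (B j′ ⟨$⟩ʳ y)) x≡ ⟨
    A i ⟨$⟩ʳ (B j′ ⟨$⟩ʳ x)                       ∎
    where
    open ≡-Reasoning
    j′ = proj₁ (AB⊆BA i₁ j)
    i′ = proj₁ (proj₂ (AB⊆BA i₁ j))
    ex = proj₂ (proj₂ (AB⊆BA i₁ j))
    z = A i′ ⟨$⟩ˡ x
    x≡ : x ≡ A i′ ⟨$⟩ʳ z
    x≡ = sym (inverseʳ (A i′))

  -- Symmetrically, if b₁ a = a′ b′, then a can be replaced by a′, and only the `A`-index changes.
  commutator-conjugateᴮ : ∀ j₁ {i j g g′} → IsCommutator i j g → Intertwines (B j₁) g g′ →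
                          IsCommutator (proj₁ (BA⊆AB j₁ i)) j g′
  commutator-conjugateᴮ j₁ {i} {j} {g} {g′} c t x = begin
    g′ ⟨$⟩ʳ (B j ⟨$⟩ʳ (A i′ ⟨$⟩ʳ x))              ≡⟨ cong (λ y → g′ ⟨$⟩ʳ (B j ⟨$⟩ʳ (A i′ ⟨$⟩ʳ y))) x≡ ⟩
    g′ ⟨$⟩ʳ (B j ⟨$⟩ʳ (A i′ ⟨$⟩ʳ (B j′ ⟨$⟩ʳ z)))  ≡⟨ cong (λ y → g′ ⟨$⟩ʳ (B j ⟨$⟩ʳ y)) (ex z) ⟨
    g′ ⟨$⟩ʳ (B j ⟨$⟩ʳ (B j₁ ⟨$⟩ʳ (A i ⟨$⟩ʳ z)))   ≡⟨ cong (g′ ⟨$⟩ʳ_) (B-commute j j₁ _) ⟩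
    g′ ⟨$⟩ʳ (B j₁ ⟨$⟩ʳ (B j ⟨$⟩ʳ (A i ⟨$⟩ʳ z)))   ≡⟨ t _ ⟩
    B j₁ ⟨$⟩ʳ (g ⟨$⟩ʳ (B j ⟨$⟩ʳ (A i ⟨$⟩ʳ z)))    ≡⟨ cong (B j₁ ⟨$⟩ʳ_) (c z) ⟩
    B j₁ ⟨$⟩ʳ (A i ⟨$⟩ʳ (B j ⟨$⟩ʳ z))             ≡⟨ ex _ ⟩
    A i′ ⟨$⟩ʳ (B j′ ⟨$⟩ʳ (B j ⟨$⟩ʳ z))            ≡⟨ cong (A i′ ⟨$⟩ʳ_) (B-commute j′ j z) ⟩
    A i′ ⟨$⟩ʳ (B j ⟨$⟩ʳ (B j′ ⟨$⟩ʳ z))            ≡⟨ cong (λ y → A i′ ⟨$⟩ʳ (B j ⟨$⟩ʳ y)) x≡ ⟨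
    A i′ ⟨$⟩ʳ (B j ⟨$⟩ʳ x)                        ∎
    where
    open ≡-Reasoning
    i′ = proj₁ (BA⊆AB j₁ i)
    j′ = proj₁ (proj₂ (BA⊆AB j₁ i))
    ex = proj₂ (proj₂ (BA⊆AB j₁ i))
    z = B j′ ⟨$⟩ˡ x
    x≡ : x ≡ B j′ ⟨$⟩ʳ z
    x≡ = sym (inverseʳ (B j′))

  -- Conjugation by `A i₂` moves only the `B`-index and conjugation by `B j₂` only the `A`-index,
  -- each independently of the other index, so both orders of conjugation turn `g` into the same
  -- commutator. Hence `g` commutes with the quotient of the two products, which is `h` once `i₂`
  -- and `j₂` index the inverses of `A i₁` and `B j₁`.
  commutators-commute : ∀ {i j i₁ j₁ g h} → IsCommutator i j g → IsCommutator i₁ j₁ h → Commute h g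
  commutators-commute {i} {j} {i₁} {j₁} {g} {h} c d x = ⟨$⟩ʳ-injective (A i₂) (⟨$⟩ʳ-injective (B j₂) (begin
    B j₂ ⟨$⟩ʳ (A i₂ ⟨$⟩ʳ (h ⟨$⟩ʳ (g ⟨$⟩ʳ x)))       ≡⟨ swap _ ⟩
    A i₂ ⟨$⟩ʳ (B j₂ ⟨$⟩ʳ (g ⟨$⟩ʳ x))                ≡⟨ cong (A i₂ ⟨$⟩ʳ_) (conjugate-intertwines (B j₂) g x) ⟨
    A i₂ ⟨$⟩ʳ (gᴮ ⟨$⟩ʳ (B j₂ ⟨$⟩ʳ x))               ≡⟨ conjugate-intertwines (A i₂) gᴮ _ ⟨
    gᴬᴮ ⟨$⟩ʳ (A i₂ ⟨$⟩ʳ (B j₂ ⟨$⟩ʳ x))              ≡⟨ commutator-unique {g = gᴬᴮ} {gᴮᴬ} cᴬᴮ cᴮᴬ _ ⟩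
    gᴮᴬ ⟨$⟩ʳ (A i₂ ⟨$⟩ʳ (B j₂ ⟨$⟩ʳ x))              ≡⟨ cong (gᴮᴬ ⟨$⟩ʳ_) (swap x) ⟨
    gᴮᴬ ⟨$⟩ʳ (B j₂ ⟨$⟩ʳ (A i₂ ⟨$⟩ʳ (h ⟨$⟩ʳ x)))     ≡⟨ conjugate-intertwines (B j₂) gᴬ _ ⟩
    B j₂ ⟨$⟩ʳ (gᴬ ⟨$⟩ʳ (A i₂ ⟨$⟩ʳ (h ⟨$⟩ʳ x)))      ≡⟨ cong (B j₂ ⟨$⟩ʳ_) (conjugate-intertwines (A i₂) g _) ⟩
    B j₂ ⟨$⟩ʳ (A i₂ ⟨$⟩ʳ (g ⟨$⟩ʳ (h ⟨$⟩ʳ x)))       ∎))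
    where
    open ≡-Reasoning
    i₂ = proj₁ (A-inverse i₁)
    j₂ = proj₁ (B-inverse j₁)
    gᴬ  = conjugate (A i₂) g
    gᴮ  = conjugate (B j₂) g
    gᴬᴮ = conjugate (A i₂) gᴮ
    gᴮᴬ = conjugate (B j₂) gᴬ
    cᴬᴮ = commutator-conjugateᴬ i₂ {g = gᴮ} {gᴬᴮ}
      (commutator-conjugateᴮ j₂ {g = g} {gᴮ} c (conjugate-intertwines (B j₂) g)) (conjugate-intertwines (A i₂) gᴮ)
    cᴮᴬ = commutator-conjugateᴮ j₂ {g = gᴬ} {gᴮᴬ}
      (commutator-conjugateᴬ i₂ {g = g} {gᴬ} c (conjugate-intertwines (A i₂) g)) (conjugate-intertwines (B j₂) gᴬ)
    cancelᴬ : ∀ y → A i₂ ⟨$⟩ʳ (A i₁ ⟨$⟩ʳ y) ≡ y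
    cancelᴬ y = trans (proj₂ (A-inverse i₁) _) (inverseˡ (A i₁))
    cancelᴬ′ : ∀ y → A i₁ ⟨$⟩ʳ (A i₂ ⟨$⟩ʳ y) ≡ y
    cancelᴬ′ y = trans (cong (A i₁ ⟨$⟩ʳ_) (proj₂ (A-inverse i₁) y)) (inverseʳ (A i₁))
    cancelᴮ : ∀ y → B j₂ ⟨$⟩ʳ (B j₁ ⟨$⟩ʳ y) ≡ y
    cancelᴮ y = trans (proj₂ (B-inverse j₁) _) (inverseˡ (B j₁))
    cancelᴮ′ : ∀ y → B j₁ ⟨$⟩ʳ (B j₂ ⟨$⟩ʳ y) ≡ y
    cancelᴮ′ y = trans (cong (B j₁ ⟨$⟩ʳ_) (proj₂ (B-inverse j₁) y)) (inverseʳ (B j₁))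
    -- h is [A i₂ ⁻¹ , B j₂ ⁻¹] = (B j₂ A i₂)⁻¹ (A i₂ B j₂).
    swap : ∀ y → B j₂ ⟨$⟩ʳ (A i₂ ⟨$⟩ʳ (h ⟨$⟩ʳ y)) ≡ A i₂ ⟨$⟩ʳ (B j₂ ⟨$⟩ʳ y)
    swap y = begin
      B j₂ ⟨$⟩ʳ (A i₂ ⟨$⟩ʳ (h ⟨$⟩ʳ y))                               ≡⟨ cong (λ y → B j₂ ⟨$⟩ʳ (A i₂ ⟨$⟩ʳ (h ⟨$⟩ʳ y))) (trans (cong (B j₁ ⟨$⟩ʳ_) (cancelᴬ′ _)) (cancelᴮ′ y)) ⟨
      B j₂ ⟨$⟩ʳ (A i₂ ⟨$⟩ʳ (h ⟨$⟩ʳ (B j₁ ⟨$⟩ʳ (A i₁ ⟨$⟩ʳ z))))       ≡⟨ cong (λ y → B j₂ ⟨$⟩ʳ (A i₂ ⟨$⟩ʳ y)) (d z) ⟩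
      B j₂ ⟨$⟩ʳ (A i₂ ⟨$⟩ʳ (A i₁ ⟨$⟩ʳ (B j₁ ⟨$⟩ʳ z)))                ≡⟨ cong (B j₂ ⟨$⟩ʳ_) (cancelᴬ _) ⟩
      B j₂ ⟨$⟩ʳ (B j₁ ⟨$⟩ʳ z)                                        ≡⟨ cancelᴮ z ⟩
      z                                                              ∎
      where z = A i₂ ⟨$⟩ʳ (B j₂ ⟨$⟩ʳ y)

  data Derived : Permutation′ n → Set where
    commutator : ∀ {g} i j → IsCommutator i j g → Derived g
    identity   : Derived id
    compose    : ∀ {g h} → Derived g → Derived h → Derived (g ↔-∘ h)
    inverse    : ∀ {g} → Derived g → Derived (flip g)

  derived-centralizer : ∀ k → (∀ g i j → IsCommutator i j g → Commute k g) →
                        ∀ {g} → Derived g → Commute k g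
  derived-centralizer k base (commutator {g} i j c) x = base g i j c x
  derived-centralizer k base identity x = refl
  derived-centralizer k base (compose {g} {h} dg dh) x =
    trans (derived-centralizer k base dg _) (cong (g ⟨$⟩ʳ_) (derived-centralizer k base dh x))
  derived-centralizer k base (inverse {g} d) = commute-flip k g (derived-centralizer k base d)

  -- Two passes: a commutator `h` commutes with all commutators, hence with `g`; so `g` commutes
  -- with all commutators, hence with every derived element.
  derived-commute : ∀ {g h} → Derived g → Derived h → Commute g h
  derived-commute {g} dg = derived-centralizer g λ h i j c x →
    sym (derived-centralizer h (λ g′ i′ j′ c′ → commutators-commute {g = g′} {h} c′ c) dg x)

  ConjugateIn : (p g : Permutation′ n) → Set
  ConjugateIn p g = ∃ λ g′ → Derived g′ × Intertwines p g g′

  derived-conjugate : ∀ p → (∀ g i j → IsCommutator i j g → ConjugateIn p g) →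
                      ∀ {g} → Derived g → ConjugateIn p g
  derived-conjugate p base (commutator {g} i j c) = base g i j c
  derived-conjugate p base identity = id , identity , λ x → refl
  derived-conjugate p base (compose {g} {h} dg dh)
    with derived-conjugate p base dg | derived-conjugate p base dh
  ... | g′ , dg′ , tg | h′ , dh′ , th =
    g′ ↔-∘ h′ , compose dg′ dh′ , λ x → trans (cong (g′ ⟨$⟩ʳ_) (th x)) (tg _)
  derived-conjugate p base (inverse {g} d) with derived-conjugate p base d
  ... | g′ , dg′ , t = flip g′ , inverse dg′ , intertwines-flip p g g′ t

  derived-conjugateᴬ : ∀ i → ∀ {g} → Derived g → ConjugateIn (A i) g
  derived-conjugateᴬ i₁ = derived-conjugate (A i₁) λ g i j c →
    let t = conjugate-intertwines (A i₁) g in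
    conjugate (A i₁) g , commutator _ _ (commutator-conjugateᴬ i₁ {g = g} {conjugate (A i₁) g} c t) , t

  derived-conjugateᴮ : ∀ j → ∀ {g} → Derived g → ConjugateIn (B j) g
  derived-conjugateᴮ j₁ = derived-conjugate (B j₁) λ g i j c →
    let t = conjugate-intertwines (B j₁) g in
    conjugate (B j₁) g , commutator _ _ (commutator-conjugateᴮ j₁ {g = g} {conjugate (B j₁) g} c t) , t

-- Translations as permutations, and iteration of maps.

module Translation (n : ℕ) .{{_ : NonZero n}} where
  open Cyclic n
  open CyclicGroup n
  open import Algebra.Properties.Group ⊕-group using (\\-leftDividesʳ; \\-leftDividesˡ)

  translation : C → Permutation′ n
  translation a = permutation (a ⊕_) (⊖ a ⊕_) (\\-leftDividesˡ a) (\\-leftDividesʳ a)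

module Iterate (n : ℕ) .{{_ : NonZero n}} where
  open Cyclic n

  iter-+ : ∀ f i j x → iter f (i + j) x ≡ iter f i (iter f j x)
  iter-+ f zero    j x = refl
  iter-+ f (suc i) j x = cong f (iter-+ f i j x)

  iter-* : ∀ f i j x → iter f (i * j) x ≡ iter (iter f j) i x
  iter-* f zero    j x = refl
  iter-* f (suc i) j x = trans (iter-+ f j (i * j) x) (cong (iter f j) (iter-* f i j x))

  iter-cong : ∀ {f g} → (∀ x → f x ≡ g x) → ∀ i x → iter f i x ≡ iter g i x
  iter-cong eq zero    x = refl
  iter-cong {f} eq (suc i) x = trans (cong f (iter-cong eq i x)) (eq _)

  iter-fixed : ∀ f i {x} → f x ≡ x → iter f i x ≡ x
  iter-fixed f zero    eq = refl
  iter-fixed f (suc i) eq = trans (cong f (iter-fixed f i eq)) eq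

  iter-intertwines : ∀ (p : C → C) {g g′ : C → C} → (∀ x → g′ (p x) ≡ p (g x)) →
                     ∀ i x → iter g′ i (p x) ≡ p (iter g i x)
  iter-intertwines p eq zero    x = refl
  iter-intertwines p {g′ = g′} eq (suc i) x =
    trans (cong g′ (iter-intertwines p eq i x)) (eq _)

  iter-compose : ∀ {f g : C → C} → (∀ x → f (g x) ≡ g (f x)) →
                 ∀ i x → iter (λ y → f (g y)) i x ≡ iter f i (iter g i x)
  iter-compose eq zero    x = refl
  iter-compose {f} {g} eq (suc i) x =
    cong f (trans (cong g (iter-compose eq i x)) (sym (iter-intertwines g eq i _)))

  stabilizer : ∀ f x → IsIdeal (λ i → iter f i x ≡ x)
  stabilizer f x = record
    { add = λ {u} {v} p q → trans (iter-+ f u v x) (trans (cong (iter f u) q) p)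
    ; sub = λ {u} {v} p q → trans (cong (iter f v) (sym q))
              (trans (sym (iter-+ f v u x)) (trans (cong (λ i → iter f i x) (+-comm v u)) p)) }

-- Orbits of an abelian permutation group normalised by the translations.

module NormalAbelian (n : ℕ) .{{_ : NonZero n}} (U : Permutation′ n → Set)
  (identity : U id)
  (compose  : ∀ {g h} → U g → U h → U (g ↔-∘ h))
  (inverse  : ∀ {g} → U g → U (flip g))
  (commute  : ∀ {g h} → U g → U h → Commute g h)
  (normal   : ∀ a {g} → U g → ∃ λ g′ → U g′ × Intertwines (Translation.translation n a) g g′)
  where

  open Cyclic n
  open CyclicGroup n
  open Iterate n
  open Translation n

  Element : Set
  Element = Σ (Permutation′ n) U

  infixr 19 _▸_
  _▸_ : Element → C → C
  (g , _) ▸ x = g ⟨$⟩ʳ x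

  infixr 29 _∙_
  _∙_ : Element → Element → Element
  (g , p) ∙ (h , q) = g ↔-∘ h , compose p q

  infix 30 _⁻¹
  _⁻¹ : Element → Element
  (g , p) ⁻¹ = flip g , inverse p

  ▸-inverseʳ : ∀ g x → g ▸ g ⁻¹ ▸ x ≡ x
  ▸-inverseʳ (g , _) x = inverseʳ g

  ▸-inverseˡ : ∀ g x → g ⁻¹ ▸ g ▸ x ≡ x
  ▸-inverseˡ (g , _) x = inverseˡ g

  ▸-commute : ∀ g h x → g ▸ h ▸ x ≡ h ▸ g ▸ x
  ▸-commute (g , p) (h , q) = commute p q

  ▸-injective : ∀ g {x y} → g ▸ x ≡ g ▸ y → x ≡ y
  ▸-injective (g , _) = ⟨$⟩ʳ-injective g

  _^_▸_ : Element → ℕ → C → C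
  g ^ i ▸ x = iter (g ▸_) i x

  ^-commute : ∀ g h i x → g ▸ (h ^ i ▸ x) ≡ h ^ i ▸ (g ▸ x)
  ^-commute g h i x = sym (iter-intertwines (g ▸_) (λ y → ▸-commute h g y) i x)

  infix 31 _at_
  -- The conjugate of an element by a translation.
  _at_ : Element → C → Element
  (g , p) at a = let g′ , p′ , _ = normal a p in g′ , p′

  at-▸ : ∀ g a x → g at a ▸ a ⊕ x ≡ a ⊕ (g ▸ x)
  at-▸ (g , p) a = proj₂ (proj₂ (normal a p))

  at-▸₀ : ∀ g a → g at a ▸ a ≡ a ⊕ (g ▸ e)
  at-▸₀ g a = trans (cong (g at a ▸_) (sym (⊕-identityʳ a))) (at-▸ g a e)

  InOrbit : C → Set
  InOrbit x = ∃ λ g → g ▸ e ≡ x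

  orbit-e : InOrbit e
  orbit-e = (id , identity) , refl

  -- The conjugate of `h` by the translation by `g ▸ e` adds `h ▸ e` to that point. Normality thus
  -- makes the orbit of `e` a subgroup of `C`.
  orbit-⊕ : ∀ {x y} → InOrbit x → InOrbit y → InOrbit (x ⊕ y)
  orbit-⊕ (g , refl) (h , refl) = h at (g ▸ e) ∙ g , at-▸₀ h (g ▸ e)

  orbit-· : ∀ i {x} → InOrbit x → InOrbit (i · x)
  orbit-· zero    p = orbit-e
  orbit-· (suc i) p = orbit-⊕ p (orbit-· i p)

  Conjugate : C → Element → Element → Set
  Conjugate a g g′ = ∀ x → g′ ▸ a ⊕ x ≡ a ⊕ (g ▸ x)

  module _ (h : Element) where
    private w = h ▸ e

    -- y ≡ y′ hⁱ modulo the stabiliser of e, where y′ is the conjugate of y by the translation by w.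
    -- For i = 1 this makes y ▸ e a fixed point of that translation.
    IsCoboundary : ℕ → Set
    IsCoboundary i = ∃₂ λ y y′ → Conjugate w y y′ × y ▸ e ≡ y′ ▸ (h ^ i ▸ e)

    -- Conjugation is a homomorphism, so the pairs `y`, `y′` multiply and invert componentwise;
    -- commutativity collects the powers of `h`.
    coboundary-ideal : IsIdeal IsCoboundary
    coboundary-ideal = record
      { add = λ { {u} {v} (y , y′ , c , p) (z , z′ , d , q) → y ∙ z , y′ ∙ z′ ,
          (λ x → trans (cong (y′ ▸_) (d x)) (c _)) , (begin
          y ▸ z ▸ e                                    ≡⟨ cong (y ▸_) q ⟩
          y ▸ z′ ▸ (h ^ v ▸ e)                         ≡⟨ ▸-commute y z′ _ ⟩
          z′ ▸ y ▸ (h ^ v ▸ e)                         ≡⟨ cong (z′ ▸_) (^-commute y h v e) ⟩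
          z′ ▸ (h ^ v ▸ (y ▸ e))                       ≡⟨ cong (λ t → z′ ▸ (h ^ v ▸ t)) p ⟩
          z′ ▸ (h ^ v ▸ (y′ ▸ (h ^ u ▸ e)))            ≡⟨ cong (z′ ▸_) (^-commute y′ h v _) ⟨
          z′ ▸ y′ ▸ (h ^ v ▸ (h ^ u ▸ e))              ≡⟨ ▸-commute z′ y′ _ ⟩
          y′ ▸ z′ ▸ (h ^ v ▸ (h ^ u ▸ e))              ≡⟨ cong (λ t → y′ ▸ z′ ▸ t) (^-+ v u) ⟩
          y′ ▸ z′ ▸ (h ^ (u + v) ▸ e)                  ∎) }
      ; sub = λ { {u} {v} (y , y′ , c , p) (z , z′ , d , q) → y ∙ z ⁻¹ , y′ ∙ z′ ⁻¹ ,
          (λ x → trans (cong (y′ ▸_) (intertwines-flip (translation w) (proj₁ z) (proj₁ z′) d x)) (c _)) ,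
          ▸-injective z (▸-injective z′ (begin
          z′ ▸ z ▸ y ▸ z ⁻¹ ▸ e                        ≡⟨ cong (z′ ▸_) (▸-commute z y _) ⟩
          z′ ▸ y ▸ z ▸ z ⁻¹ ▸ e                        ≡⟨ cong (λ t → z′ ▸ y ▸ t) (▸-inverseʳ z e) ⟩
          z′ ▸ y ▸ e                                   ≡⟨ cong (z′ ▸_) p ⟩
          z′ ▸ y′ ▸ (h ^ (u + v) ▸ e)                  ≡⟨ cong (λ t → z′ ▸ y′ ▸ t) (^-+ v u) ⟨
          z′ ▸ y′ ▸ (h ^ v ▸ (h ^ u ▸ e))              ≡⟨ ▸-commute z′ y′ _ ⟩
          y′ ▸ z′ ▸ (h ^ v ▸ (h ^ u ▸ e))              ≡⟨ cong (y′ ▸_) (^-commute z′ h v _) ⟩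
          y′ ▸ (h ^ v ▸ (z′ ▸ (h ^ u ▸ e)))            ≡⟨ cong (λ t → y′ ▸ (h ^ v ▸ t)) q ⟨
          y′ ▸ (h ^ v ▸ (z ▸ e))                       ≡⟨ cong (y′ ▸_) (^-commute z h v e) ⟨
          y′ ▸ z ▸ (h ^ v ▸ e)                         ≡⟨ ▸-commute y′ z _ ⟩
          z ▸ y′ ▸ (h ^ v ▸ e)                         ≡⟨ cong (λ t → z ▸ y′ ▸ t) (▸-inverseʳ z′ _) ⟨
          z ▸ y′ ▸ z′ ▸ z′ ⁻¹ ▸ (h ^ v ▸ e)            ≡⟨ cong (z ▸_) (▸-commute y′ z′ _) ⟩
          z ▸ z′ ▸ y′ ▸ z′ ⁻¹ ▸ (h ^ v ▸ e)            ≡⟨ ▸-commute z z′ _ ⟩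
          z′ ▸ z ▸ y′ ▸ z′ ⁻¹ ▸ (h ^ v ▸ e)            ∎)) } }
      where
      open ≡-Reasoning
      ^-+ : ∀ v u → h ^ v ▸ (h ^ u ▸ e) ≡ h ^ (u + v) ▸ e
      ^-+ v u = trans (sym (iter-+ (h ▸_) v u e)) (cong (λ i → h ^ i ▸ e) (+-comm v u))

    private
      multiple : ℕ → Element
      multiple zero    = id , identity
      multiple (suc i) = multiple i at w ∙ h

      multiple-▸ : ∀ i → multiple i ▸ e ≡ i · w
      multiple-▸ zero    = refl
      multiple-▸ (suc i) = trans (at-▸₀ (multiple i) w) (cong (w ⊕_) (multiple-▸ i))

      product product′ : ℕ → Element
      product zero    = id , identity
      product (suc i) = multiple i ∙ product i
      product′ zero    = id , identity
      product′ (suc i) = multiple i at w ∙ product′ i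

      product-conjugate : ∀ i → Conjugate w (product i) (product′ i)
      product-conjugate zero    x = refl
      product-conjugate (suc i) x =
        trans (cong (multiple i at w ▸_) (product-conjugate i x)) (at-▸ (multiple i) w _)

      -- An averaged crossed homomorphism: each `multiple` is the conjugate of the previous one
      -- times `h`. The product of those with indices 1 to `i` is therefore `product i` times
      -- `multiple i`, but also `product′ i` times the `i`-th power of `h`; both are evaluated at
      -- `e`.
      product-shift : ∀ i → product i ▸ i · w ≡ product′ i ▸ (h ^ i ▸ e)
      product-shift zero    = refl
      product-shift (suc i) = begin
        m ▸ p ▸ w ⊕ (i · w)              ≡⟨ cong (λ t → m ▸ p ▸ w ⊕ t) (multiple-▸ i) ⟨
        m ▸ p ▸ w ⊕ (m ▸ e)              ≡⟨ cong (λ t → m ▸ p ▸ t) (at-▸₀ m w) ⟨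
        m ▸ p ▸ m′ ▸ h ▸ e               ≡⟨ cong (m ▸_) (▸-commute p m′ _) ⟩
        m ▸ m′ ▸ p ▸ h ▸ e               ≡⟨ cong (λ t → m ▸ m′ ▸ t) (▸-commute p h e) ⟩
        m ▸ m′ ▸ h ▸ p ▸ e               ≡⟨ ▸-commute m m′ _ ⟩
        m′ ▸ m ▸ h ▸ p ▸ e               ≡⟨ cong (m′ ▸_) (▸-commute m h _) ⟩
        m′ ▸ h ▸ m ▸ p ▸ e               ≡⟨ cong (λ t → m′ ▸ h ▸ t) (▸-commute m p _) ⟩
        m′ ▸ h ▸ p ▸ m ▸ e               ≡⟨ cong (λ t → m′ ▸ h ▸ p ▸ t) (multiple-▸ i) ⟩
        m′ ▸ h ▸ p ▸ i · w               ≡⟨ cong (λ t → m′ ▸ h ▸ t) (product-shift i) ⟩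
        m′ ▸ h ▸ p′ ▸ (h ^ i ▸ e)        ≡⟨ cong (m′ ▸_) (▸-commute h p′ _) ⟩
        m′ ▸ p′ ▸ h ▸ (h ^ i ▸ e)        ∎
        where
        open ≡-Reasoning
        m  = multiple i
        m′ = multiple i at w
        p  = product i
        p′ = product′ i

    -- The coboundary condition holds at `u` by `product-shift` and trivially at `v`, hence at 1.
    -- There `y′` maps `w` to `y ▸ e` and, as the conjugate of `y`, also to `w ⊕ (y ▸ e)`.
    coprime-period⇒fixed : ∀ {u v} → Coprime u v → u · w ≡ e → h ^ v ▸ e ≡ e → w ≡ e
    coprime-period⇒fixed {u} {v} cop uw≡e hᵛe≡e =
      let y , y′ , c , p = IsIdeal.has-1 coboundary-ideal cop
            (product u , product′ u , product-conjugate u ,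
              trans (cong (product u ▸_) (sym uw≡e)) (product-shift u))
            ((id , identity) , (id , identity) , (λ x → refl) , sym hᵛe≡e)
      in ⊕-cancelˡ (y ▸ e) (trans (⊕-comm (y ▸ e) w) (trans (sym (c e))
           (trans (cong (y′ ▸_) (⊕-identityʳ w)) (trans (sym p) (sym (⊕-identityʳ (y ▸ e)))))))

-- Prime factors, cycle lengths and torsion.

prime∤⇒coprime : ∀ {p m} → Prime p → ¬ p ∣ m → Coprime p m
prime∤⇒coprime {p} pr p∤m (d∣p , d∣m) with prime⇒irreducible pr d∣p
... | inj₁ d≡1 = d≡1
... | inj₂ refl = ⊥-elim (p∤m d∣m)

coprime-^ : ∀ {m n} k → Coprime m n → Coprime m (n ℕ.^ k)
coprime-^ zero    cop (d∣m , d∣1) = ∣1⇒≡1 d∣1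
coprime-^ (suc k) cop {d} (d∣m , d∣nnᵏ) = coprime-^ k cop
  (d∣m , coprime-divisor (λ { (i∣d , i∣n) → cop (∣-trans i∣d d∣m , i∣n) }) d∣nnᵏ)

prime-power-factor : ∀ {p} → Prime p → ∀ m .{{_ : NonZero m}} → ∃₂ λ k o → m ≡ p ℕ.^ k * o × Coprime p o
prime-power-factor {p} pr m = <-rec Q step m
  where
  Q : ℕ → Set
  Q m = .{{_ : NonZero m}} → ∃₂ λ k o → m ≡ p ℕ.^ k * o × Coprime p o
  step : ∀ m → (∀ {l} → l < m → Q l) → Q m
  step m rec with p ∣? m
  ... | no p∤m = 0 , m , sym (*-identityˡ m) , prime∤⇒coprime pr p∤m
  ... | yes (divides q refl) =
    let instance q≢0 = m*n≢0⇒m≢0 q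
        k , o , q≡ , cop = rec {q} (m<m*n q p {{q≢0}} (nonTrivial⇒n>1 p {{prime⇒nonTrivial pr}})) {{q≢0}}
    in suc k , o , trans (cong (_* p) q≡) (trans (*-comm _ p) (sym (*-assoc p _ o))) , cop

m≤n⇒m∣n! : ∀ {m n} .{{_ : NonZero m}} → m ≤ n → m ∣ n !
m≤n⇒m∣n! {suc m} m≤n = ∣-trans (m∣m*n (m !)) (m≤n⇒m!∣n! m≤n)

module _ (n : ℕ) .{{_ : NonZero n}} where
  open Cyclic n
  open CyclicGroup n
  open Iterate n

  iter-injective : ∀ {f : C → C} → (∀ {x y} → f x ≡ f y → x ≡ y) →
                   ∀ i {x y} → iter f i x ≡ iter f i y → x ≡ y
  iter-injective inj zero    eq = eq
  iter-injective inj (suc i) eq = iter-injective inj i (inj eq)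

  iter-∸ : ∀ {f : C → C} → (∀ {x y} → f x ≡ f y → x ≡ y) →
           ∀ {i j x} → i ≤ j → iter f i x ≡ iter f j x → iter f (j ∸ i) x ≡ x
  iter-∸ {f} inj {i} {j} {x} i≤j eq = iter-injective inj i
    (trans (sym (iter-+ f i (j ∸ i) x)) (trans (cong (λ t → iter f t x) (m+[n∸m]≡n i≤j)) (sym eq)))

  -- Two of the first `n + 1` iterates of `x` agree, which gives a positive period of at most `n`, a
  -- divisor of `n !`. One exponent thus serves all permutations of `C`.
  iter-! : ∀ {f : C → C} → (∀ {x y} → f x ≡ f y → x ≡ y) → ∀ x → iter f (n !) x ≡ x
  iter-! {f} inj x with pigeonhole ≤-refl (λ (i : Fin (suc n)) → iter f (toℕ i) x)
  ... | i , j , i<j , eq =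
    let instance j∸i≢0 = >-nonZero (m<n⇒0<n∸m i<j)
        divides q n!≡ = m≤n⇒m∣n! {toℕ j ∸ toℕ i} {n} (≤-trans (m∸n≤m (toℕ j) (toℕ i)) (s≤s⁻¹ (toℕ<n j)))
    in subst (λ t → iter f t x ≡ x) (sym n!≡)
         (IsIdeal.mul (stabilizer f x) q (iter-∸ inj (<⇒≤ i<j) eq))

  -- The factor `n ∸ 1` acts as negation, so that inverses remain multiples by natural numbers.
  pred·⊕ : ∀ x → ((n ∸ 1) · x) ⊕ x ≡ e
  pred·⊕ x = trans (⊕-comm _ x) (trans (cong (_· x) (m+[n∸m]≡n (>-nonZero⁻¹ n))) (n·x≡e x))

  multiples-cancel : ∀ {v x y} → (∃ λ i → x ⊕ y ≡ i · v) → (∃ λ i → x ≡ i · v) → ∃ λ i → y ≡ i · v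
  multiples-cancel {v} {x} {y} (i , p) (j , q) = (n ∸ 1) * j + i , (begin
    y                               ≡⟨ ⊕-identityˡ y ⟨
    e ⊕ y                           ≡⟨ cong (_⊕ y) (pred·⊕ x) ⟨
    (((n ∸ 1) · x) ⊕ x) ⊕ y         ≡⟨ ⊕-assoc _ x y ⟩
    ((n ∸ 1) · x) ⊕ (x ⊕ y)         ≡⟨ cong₂ _⊕_ (cong ((n ∸ 1) ·_) q) p ⟩
    ((n ∸ 1) · j · v) ⊕ (i · v)     ≡⟨ cong (_⊕ (i · v)) (·-assocˡ v (n ∸ 1) j) ⟩
    (((n ∸ 1) * j) · v) ⊕ (i · v)   ≡⟨ ·-homo-+ v ((n ∸ 1) * j) i ⟨
    ((n ∸ 1) * j + i) · v           ∎)
    where open ≡-Reasoning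

  module _ {s N : ℕ} (s-prime : Prime s) (n≡sN : n ≡ s * N) where
    private
      instance
        s≢0 : NonZero s
        s≢0 = prime⇒nonZero s-prime

    torsion-multiple : ∀ {v} → s · v ≡ e → ∃ λ t → v ≡ t · [ N ]
    torsion-multiple {v} sv≡e
      with divides t eq ← *-cancelˡ-∣ {N} s (subst (_∣ s * toℕ v) n≡sN
             ([]≡e⇒∣ (trans (sym (·-toℕ s v)) sv≡e)))
      = t , trans (sym ([]-toℕ v)) (trans (cong [_] eq) (sym (·-[] t N)))

    abstract
      -- The numbers `j` for which `j · [ N ]` is a multiple of `v` include `s` and the factor `t`
      -- of `v`, which are coprime; hence `[ N ]`, and with it `w`, is a multiple of `v`. Reducing
      -- the factor modulo `s` prepares the count in `powers-exhaust`.
      torsion-cyclic : ∀ {v w} → v ≢ e → s · v ≡ e → s · w ≡ e → ∃ λ (i : Fin s) → w ≡ toℕ i · v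
      torsion-cyclic {v} {w} v≢e sv≡e sw≡e = Fin.fromℕ< (m%n<n k s) , trans w≡kv (sym (begin
          toℕ (Fin.fromℕ< (m%n<n k s)) · v       ≡⟨ cong (_· v) (toℕ-fromℕ< (m%n<n k s)) ⟩
          (k % s) · v                            ≡⟨ ⊕-identityʳ _ ⟨
          ((k % s) · v) ⊕ e                      ≡⟨ cong (((k % s) · v) ⊕_) (·-e (k / s)) ⟨
          ((k % s) · v) ⊕ ((k / s) · e)          ≡⟨ cong (λ t → ((k % s) · v) ⊕ ((k / s) · t)) sv≡e ⟨
          ((k % s) · v) ⊕ ((k / s) · s · v)      ≡⟨ cong (((k % s) · v) ⊕_) (·-assocˡ v (k / s) s) ⟩
          ((k % s) · v) ⊕ ((k / s * s) · v)      ≡⟨ ·-homo-+ v (k % s) (k / s * s) ⟨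
          (k % s + k / s * s) · v                ≡⟨ cong (_· v) (m≡m%n+[m/n]*n k s) ⟨
          k · v                                  ∎))
        where
        open ≡-Reasoning
        t r : ℕ
        t = proj₁ (torsion-multiple sv≡e)
        r = proj₁ (torsion-multiple sw≡e)
        v≡ : v ≡ t · [ N ]
        v≡ = proj₂ (torsion-multiple sv≡e)
        w≡ : w ≡ r · [ N ]
        w≡ = proj₂ (torsion-multiple sw≡e)
        s[N]≡e : s · [ N ] ≡ e
        s[N]≡e = trans (·-[] s N) (∣⇒[]≡e (subst (_∣ s * N) (sym n≡sN) ∣-refl))
        s∤t : ¬ s ∣ t
        s∤t (divides q t≡qs) = v≢e (trans v≡ (trans (cong (_· [ N ]) t≡qs)
          (trans (sym (·-assocˡ [ N ] q s)) (trans (cong (q ·_) s[N]≡e) (·-e q)))))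
        ideal : IsIdeal (λ j → ∃ λ i → j · [ N ] ≡ i · v)
        ideal = record
          { add = λ { {a} {b} (i , p) (j , q) → i + j ,
              trans (·-homo-+ [ N ] a b) (trans (cong₂ _⊕_ p q) (sym (·-homo-+ v i j))) }
          ; sub = λ { {a} {b} (i , p) q → multiples-cancel {v} {a · [ N ]}
              (i , trans (sym (·-homo-+ [ N ] a b)) p) q } }
        k′ : ∃ λ i → (r * 1) · [ N ] ≡ i · v
        k′ = IsIdeal.mul ideal r (IsIdeal.has-1 ideal (prime∤⇒coprime s-prime s∤t) (0 , s[N]≡e)
               (1 , trans (sym v≡) (sym (⊕-identityʳ v))))
        k : ℕ
        k = proj₁ k′
        w≡kv : w ≡ k · v
        w≡kv = trans w≡ (trans (cong (_· [ N ]) (sym (*-identityʳ r))) (proj₂ k′))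

-- The Sylow `s`-subgroup of the abelian group and its orbits.

module PrimaryPart (n : ℕ) .{{_ : NonZero n}} (U : Permutation′ n → Set)
  (identity : U id)
  (compose  : ∀ {g h} → U g → U h → U (g ↔-∘ h))
  (inverse  : ∀ {g} → U g → U (flip g))
  (commute  : ∀ {g h} → U g → U h → Commute g h)
  (normal   : ∀ a {g} → U g → ∃ λ g′ → U g′ × Intertwines (Translation.translation n a) g g′)
  {s N : ℕ} (s-prime : Prime s) (n≡sN : n ≡ s * N) (s⊥N : Coprime s N)
  -- A common period of all permutations of C, split into its s-part and the rest.
  {k o : ℕ} (n!≡ : n ! ≡ s ℕ.^ k * o) (s⊥o : Coprime s o)
  where

  open Cyclic n
  open CyclicGroup n
  open Iterate n
  open Translation n
  open import Algebra.Properties.Group ⊕-group using (\\-leftDividesʳ; \\-leftDividesˡ)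
  private
    module U = NormalAbelian n U identity compose inverse commute normal

  -- Every permutation of `C` has period `n !`, so its order is a power of `s` exactly when it
  -- divides `s ^ k`. `Primary` is thus the Sylow subgroup.
  HasPrimaryPeriod : Permutation′ n → Set
  HasPrimaryPeriod g = ∀ x → iter (g ⟨$⟩ʳ_) (s ℕ.^ k) x ≡ x

  Primary : Permutation′ n → Set
  Primary g = U g × HasPrimaryPeriod g

  period-conjugate : ∀ {p g g′} → Intertwines p g g′ → HasPrimaryPeriod g → HasPrimaryPeriod g′
  period-conjugate {p} {g} {g′} t period x = subst (λ y → iter (g′ ⟨$⟩ʳ_) (s ℕ.^ k) y ≡ y) (inverseʳ p)
    (trans (iter-intertwines (p ⟨$⟩ʳ_) t (s ℕ.^ k) _) (cong (p ⟨$⟩ʳ_) (period _)))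

  primary-identity : Primary id
  primary-identity = identity , λ x → iter-fixed (λ y → y) (s ℕ.^ k) refl

  primary-compose : ∀ {g h} → Primary g → Primary h → Primary (g ↔-∘ h)
  primary-compose {g} {h} (p , i) (q , j) = compose p q ,
    λ x → trans (iter-compose {f = g ⟨$⟩ʳ_} {h ⟨$⟩ʳ_} (commute p q) (s ℕ.^ k) x)
            (trans (cong (iter (g ⟨$⟩ʳ_) (s ℕ.^ k)) (j x)) (i x))

  primary-inverse : ∀ {g} → Primary g → Primary (flip g)
  primary-inverse {g} (p , i) = inverse p , λ x → iter-injective n (⟨$⟩ʳ-injective g) (s ℕ.^ k)
    (trans (sym (iter-compose {f = g ⟨$⟩ʳ_} {g ⟨$⟩ˡ_} (λ y → trans (inverseʳ g) (sym (inverseˡ g))) (s ℕ.^ k) x))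
      (trans (iter-cong (λ y → inverseʳ g) (s ℕ.^ k) x)
        (trans (iter-fixed (λ y → y) (s ℕ.^ k) refl) (sym (i x)))))

  primary-commute : ∀ {g h} → Primary g → Primary h → Commute g h
  primary-commute (p , _) (q , _) = commute p q

  primary-normal : ∀ a {g} → Primary g → ∃ λ g′ → Primary g′ × Intertwines (translation a) g g′
  primary-normal a {g} (p , i) = let g′ , p′ , t = normal a p in
    g′ , (p′ , period-conjugate {translation a} {g} {g′} t i) , t

  module Sylow = NormalAbelian n Primary
    primary-identity primary-compose primary-inverse primary-commute primary-normal

  open Sylow

  -- Some primary `h` carries `e` to `s · (g ▸ e)`. This point is annihilated by `N`, while `e` has
  -- the coprime period `s ^ k` under `h`.
  orbit⊆torsion : ∀ g → s · (g ▸ e) ≡ e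
  orbit⊆torsion g = let h , h▸e≡ = orbit-· s (g , refl) in trans (sym h▸e≡)
    (coprime-period⇒fixed h (coprime-^ k (coprime-sym s⊥N))
      (trans (cong (N ·_) h▸e≡) (trans (·-assocˡ (g ▸ e) N s)
        (trans (cong (_· (g ▸ e)) (trans (*-comm N s) (sym n≡sN))) (n·x≡e (g ▸ e)))))
      (proj₂ (proj₂ h) e))

  module _ {c : C} (c-orbit : U.InOrbit c) (sc≡e : s · c ≡ e) (c≢e : c ≢ e) where

    private
      power : Element → ℕ → Element
      power g zero    = id , primary-identity
      power g (suc i) = g ∙ power g i

      power-▸ : ∀ g i x → power g i ▸ x ≡ g ^ i ▸ x
      power-▸ g zero    x = refl
      power-▸ g (suc i) x = cong (g ▸_) (power-▸ g i x)

      h : U.Element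
      h = proj₁ c-orbit

      powerᵁ : ℕ → U.Element
      powerᵁ zero    = id , identity
      powerᵁ (suc i) = h U.∙ powerᵁ i

      powerᵁ-▸ : ∀ i x → powerᵁ i U.▸ x ≡ h U.^ i ▸ x
      powerᵁ-▸ zero    x = refl
      powerᵁ-▸ (suc i) x = cong (h U.▸_) (powerᵁ-▸ i x)

    -- The `o`-th power of the element carrying `e` to `c` is primary. If it fixed `e`, the coprime
    -- numbers `s`, annihilating `c`, and `o`, a period of `e`, would force `c ≡ e`.
    nontrivial : ∃ λ z → z ▸ e ≢ e
    nontrivial = (proj₁ (powerᵁ o) , (proj₂ (powerᵁ o) , period)) , λ z▸e≡e →
      c≢e (trans (sym (proj₂ c-orbit)) (U.coprime-period⇒fixed h s⊥o
        (trans (cong (s ·_) (proj₂ c-orbit)) sc≡e) (trans (sym (powerᵁ-▸ o e)) z▸e≡e)))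
      where
      period : HasPrimaryPeriod (proj₁ (powerᵁ o))
      period x = begin
        iter (powerᵁ o U.▸_) (s ℕ.^ k) x            ≡⟨ iter-cong (powerᵁ-▸ o) (s ℕ.^ k) x ⟩
        iter (iter (h U.▸_) o) (s ℕ.^ k) x          ≡⟨ iter-* (h U.▸_) (s ℕ.^ k) o x ⟨
        iter (h U.▸_) (s ℕ.^ k * o) x               ≡⟨ cong (λ i → iter (h U.▸_) i x) n!≡ ⟨
        iter (h U.▸_) (n !) x                     ≡⟨ iter-! n (U.▸-injective h) x ⟩
        x                                         ∎
        where open ≡-Reasoning

    torsion⊆orbit : ∀ {w} → s · w ≡ e → InOrbit w
    torsion⊆orbit sw≡e =
      let z , z▸e≢e = nontrivial
          i , w≡ = torsion-cyclic n s-prime n≡sN z▸e≢e (orbit⊆torsion z) sw≡e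
      in subst InOrbit (sym w≡) (orbit-· (toℕ i) (z , refl))

    -- Pigeonhole on `w` and the first `s` iterates of `e` under `y`, all multiples of `y ▸ e` by an
    -- index in `Fin s`. A coincidence without `w` gives `e` a positive period below `s`; it is
    -- coprime to `s ^ k`, so `y` would fix `e`.
    powers-exhaust : ∀ y → y ▸ e ≢ e → ∀ {w} → s · w ≡ e → ∃ λ i → y ^ i ▸ e ≡ w
    powers-exhaust y y▸e≢e {w} sw≡e = conclude (pigeonhole ≤-refl λ i → proj₁ (index i))
      where
      point : Fin (suc s) → C
      point Fin.zero    = w
      point (Fin.suc i) = y ^ toℕ i ▸ e
      torsion : ∀ i → s · point i ≡ e
      torsion Fin.zero    = sw≡e
      torsion (Fin.suc i) = trans (cong (s ·_) (sym (power-▸ y (toℕ i) e))) (orbit⊆torsion (power y (toℕ i)))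
      index : ∀ i → ∃ λ (j : Fin s) → point i ≡ toℕ j · (y ▸ e)
      index i = torsion-cyclic n s-prime n≡sN y▸e≢e (orbit⊆torsion y) (torsion i)
      same-point : ∀ {i j} → proj₁ (index i) ≡ proj₁ (index j) → point i ≡ point j
      same-point {i} {j} eq = trans (proj₂ (index i))
        (trans (cong (λ l → toℕ l · (y ▸ e)) eq) (sym (proj₂ (index j))))
      conclude : (∃₂ λ i j → i Fin.< j × proj₁ (index i) ≡ proj₁ (index j)) → ∃ λ i → y ^ i ▸ e ≡ w
      conclude (Fin.zero , Fin.suc j , _ , eq) = toℕ j , sym (same-point {Fin.zero} {Fin.suc j} eq)
      conclude (Fin.suc i , Fin.suc j , s≤s i<j , eq) = ⊥-elim (y▸e≢e
        (IsIdeal.has-1 (stabilizer (y ▸_) e)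
          (coprime-sym (coprime-^ k (coprime-sym (prime∤⇒coprime s-prime s∤d))))
          (proj₂ (proj₂ y) e)
          (iter-∸ n (▸-injective y) (<⇒≤ i<j) (same-point {Fin.suc i} {Fin.suc j} eq))))
        where
        s∤d : ¬ s ∣ toℕ j ∸ toℕ i
        s∤d s∣d = <⇒≱ (toℕ<n j) (≤-trans (∣⇒≤ {{>-nonZero (m<n⇒0<n∸m i<j)}} s∣d) (m∸n≤m (toℕ j) (toℕ i)))

    -- Otherwise `d`, the quotient of `g` by its conjugate, moves `e`, and some `i`-th power of `d`
    -- carries `e` to `a`. Then the `i`-th power of `g` sends `e` where that of `g′` sends `a`,
    -- namely to `a ⊕ (g ^ i ▸ e)`. So `a ≡ e`, and the conjugation was trivial.
    at-torsion : ∀ g {a} → s · a ≡ e → g at a ▸ e ≡ g ▸ e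
    at-torsion g {a} sa≡e with g at a ▸ e ≟ g ▸ e
    ... | yes eq = eq
    ... | no neq = ⊥-elim (neq (trans (cong (λ b → g at b ▸ e) a≡e)
        (trans (at-▸₀ g e) (⊕-identityˡ _))))
      where
      open ≡-Reasoning
      g′ = g at a
      d = g ∙ g′ ⁻¹
      d▸e≢e : d ▸ e ≢ e
      d▸e≢e eq = neq (trans (cong (g′ ▸_) (sym eq))
        (trans (▸-commute g′ g _) (cong (g ▸_) (▸-inverseʳ g′ e))))
      i = proj₁ (powers-exhaust d d▸e≢e sa≡e)
      gⁱ-fixed : g ^ i ▸ e ≡ a ⊕ (g ^ i ▸ e)
      gⁱ-fixed = begin
        g ^ i ▸ e                               ≡⟨ iter-cong (λ x → trans (▸-commute g′ d x) (cong (g ▸_) (▸-inverseˡ g′ x))) i e ⟨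
        iter (λ x → g′ ▸ d ▸ x) i e             ≡⟨ iter-compose (▸-commute g′ d) i e ⟩
        g′ ^ i ▸ (d ^ i ▸ e)                    ≡⟨ cong (g′ ^ i ▸_) (proj₂ (powers-exhaust d d▸e≢e sa≡e)) ⟩
        g′ ^ i ▸ a                              ≡⟨ cong (g′ ^ i ▸_) (⊕-identityʳ a) ⟨
        g′ ^ i ▸ (a ⊕ e)                        ≡⟨ iter-intertwines (a ⊕_) (at-▸ g a) i e ⟩
        a ⊕ (g ^ i ▸ e)                         ∎
      a≡e : a ≡ e
      a≡e = ⊕-cancelˡ (g ^ i ▸ e) (trans (⊕-comm _ a) (trans (sym gⁱ-fixed) (sym (⊕-identityʳ _))))

    -- With `a` written as `t ▸ e`, commutativity moves `t` past `g`, and `at-torsion` replaces `g`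
    -- by its conjugate.
    ▸-torsion₀ : ∀ g {a} → s · a ≡ e → g ▸ a ≡ a ⊕ (g ▸ e)
    ▸-torsion₀ g {a} sa≡e = begin
      g ▸ a                       ≡⟨ cong (g ▸_) t▸e≡a ⟨
      g ▸ t ▸ e                   ≡⟨ ▸-commute g t e ⟩
      t ▸ g ▸ e                   ≡⟨ cong (t ▸_) (at-torsion g sa≡e) ⟨
      t ▸ g at a ▸ e              ≡⟨ ▸-commute t (g at a) e ⟩
      g at a ▸ t ▸ e              ≡⟨ cong (g at a ▸_) t▸e≡a ⟩
      g at a ▸ a                  ≡⟨ at-▸₀ g a ⟩
      a ⊕ (g ▸ e)                 ∎
      where
      open ≡-Reasoning
      t = proj₁ (torsion⊆orbit sa≡e)
      t▸e≡a = proj₂ (torsion⊆orbit sa≡e)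

    module _ (g : Element) (x : C) where
      private
        -- This conjugate does at `e` what `g` does at `x`.
        g₀ = g at (⊖ x)
        back : ∀ a → g ▸ x ⊕ a ≡ x ⊕ (g₀ ▸ a)
        back a = sym (trans (cong (λ t → x ⊕ (g₀ ▸ t)) (sym (\\-leftDividesʳ x a)))
          (trans (cong (x ⊕_) (at-▸ g (⊖ x) (x ⊕ a))) (\\-leftDividesˡ x _)))
        at-e : g ▸ x ≡ x ⊕ (g₀ ▸ e)
        at-e = trans (cong (g ▸_) (sym (⊕-identityʳ x))) (back e)

      displacement : ∃ λ v → s · v ≡ e × g ▸ x ≡ x ⊕ v
      displacement = g₀ ▸ e , orbit⊆torsion g₀ , at-e

      ▸-torsion : ∀ {a} → s · a ≡ e → g ▸ x ⊕ a ≡ (g ▸ x) ⊕ a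
      ▸-torsion {a} sa≡e = begin
        g ▸ x ⊕ a                   ≡⟨ back a ⟩
        x ⊕ (g₀ ▸ a)                ≡⟨ cong (x ⊕_) (trans (▸-torsion₀ g₀ sa≡e) (⊕-comm a _)) ⟩
        x ⊕ ((g₀ ▸ e) ⊕ a)          ≡⟨ ⊕-assoc x _ a ⟨
        (x ⊕ (g₀ ▸ e)) ⊕ a          ≡⟨ cong (_⊕ a) at-e ⟨
        (g ▸ x) ⊕ a                 ∎
        where open ≡-Reasoning

    translate-by : ∀ x {w} → s · w ≡ e → ∃ λ g → g ▸ x ≡ x ⊕ w
    translate-by x sw≡e = let h , h▸e≡w = torsion⊆orbit sw≡e in
      h at x , trans (at-▸₀ h x) (cong (x ⊕_) h▸e≡w)

    module _ (p : Permutation′ n) (p-normal : ∀ {g} → U g → ∃ λ g′ → U g′ × Intertwines p g g′) where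
      private
        φ : C → C
        φ = p ⟨$⟩ʳ_

        _ᵖ : Element → Element
        (g , q , period) ᵖ = let g′ , q′ , t = p-normal q in
          g′ , q′ , period-conjugate {p} {g} {g′} t period

        ᵖ-▸ : ∀ g x → g ᵖ ▸ φ x ≡ φ (g ▸ x)
        ᵖ-▸ (g , q , _) = proj₂ (proj₂ (p-normal q))

      torsion-block : ∀ x {w} → s · w ≡ e → ∃ λ v → s · v ≡ e × φ (x ⊕ w) ≡ φ x ⊕ v
      torsion-block x sw≡e =
        let g , g▸x≡ = translate-by x sw≡e
            v , sv≡e , eq = displacement (g ᵖ) (φ x)
        in v , sv≡e , trans (cong φ (sym g▸x≡)) (trans (sym (ᵖ-▸ g x)) eq)

      -- The primary `g` carrying `x` to `x ⊕ w` translates the coset of `x`, and its conjugate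
      -- under `p` translates the image coset. This transports the pair `v`, `v′` from `x` to
      -- `x ⊕ w`.
      torsion-affine : ∀ x {v w v′} → s · v ≡ e → s · w ≡ e → s · v′ ≡ e →
        φ (x ⊕ v) ≡ φ x ⊕ v′ → φ ((x ⊕ w) ⊕ v) ≡ φ (x ⊕ w) ⊕ v′
      torsion-affine x {v} {w} {v′} sv≡e sw≡e sv′≡e eq = begin
        φ ((x ⊕ w) ⊕ v)           ≡⟨ cong (λ t → φ (t ⊕ v)) g▸x≡ ⟨
        φ ((g ▸ x) ⊕ v)           ≡⟨ cong φ (▸-torsion g x sv≡e) ⟨
        φ (g ▸ x ⊕ v)             ≡⟨ ᵖ-▸ g (x ⊕ v) ⟨
        g ᵖ ▸ φ (x ⊕ v)           ≡⟨ cong (g ᵖ ▸_) eq ⟩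
        g ᵖ ▸ φ x ⊕ v′          ≡⟨ ▸-torsion (g ᵖ) _ sv′≡e ⟩
        (g ᵖ ▸ φ x) ⊕ v′          ≡⟨ cong (_⊕ v′) (ᵖ-▸ g x) ⟩
        φ (g ▸ x) ⊕ v′          ≡⟨ cong (λ t → φ t ⊕ v′) g▸x≡ ⟩
        φ (x ⊕ w) ⊕ v′          ∎
        where
        open ≡-Reasoning
        g = proj₁ (translate-by x sw≡e)
        g▸x≡ = proj₂ (translate-by x sw≡e)

-- Sums over a transversal of the torsion subgroup.

module Transversal (n : ℕ) .{{_ : NonZero n}} {s N : ℕ} (s-prime : Prime s) (n≡sN : n ≡ s * N) where
  open Cyclic n
  open CyclicGroup n
  open import Algebra.Properties.CommutativeMonoid.Sum ⊕-commutativeMonoid using (sum; sum-permute; sum-cong-≗)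

  private
    instance
      s≢0 : NonZero s
      s≢0 = prime⇒nonZero s-prime
      N≢0 : NonZero N
      N≢0 = m*n≢0⇒n≢0 s {{subst NonZero n≡sN (>-nonZero (>-nonZero⁻¹ n))}}

  Torsion : C → Set
  Torsion v = s · v ≡ e

  torsion-⊕ : ∀ {v w} → Torsion v → Torsion w → Torsion (v ⊕ w)
  torsion-⊕ {v} {w} p q = trans (·-distrib-⊕ v w s) (trans (cong₂ _⊕_ p q) (⊕-identityˡ e))

  torsion-cancel : ∀ v {w} → Torsion (v ⊕ w) → Torsion v → Torsion w
  torsion-cancel v {w} p q = trans (sym (⊕-identityˡ (s · w)))
    (trans (cong (_⊕ (s · w)) (sym q)) (trans (sym (·-distrib-⊕ v w s)) p))

  torsion-· : ∀ i {v} → Torsion v → Torsion (i · v)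
  torsion-· i {v} p = trans (·-assocˡ v s i) (trans (cong (_· v) (*-comm s i))
    (trans (sym (·-assocˡ v i s)) (trans (cong (i ·_) p) (·-e i))))

  torsion-⊖ : ∀ {v} → Torsion v → Torsion (⊖ v)
  torsion-⊖ {v} p = torsion-cancel v (subst Torsion (sym (⊕-inverseʳ v)) (·-e s)) p

  Periodic : (C → C) → Set
  Periodic g = ∀ x {v} → Torsion v → g (x ⊕ v) ≡ g x

  PreservesBlocks : (C → C) → Set
  PreservesBlocks θ = ∀ x {w} → Torsion w → ∃ λ v → Torsion v × θ (x ⊕ w) ≡ θ x ⊕ v

  private
    -- The torsion is generated by `[ N ]`, so its cosets are the residue classes modulo `N`.
    rep : C → Fin N
    rep x = toℕ x mod N

  representative : ∀ x → ∃ λ v → Torsion v × x ≡ [ toℕ (rep x) ] ⊕ v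
  representative x = [ m / N * N ] ,
    trans (·-[] s (m / N * N)) (∣⇒[]≡e (subst (_∣ s * (m / N * N)) (sym n≡sN)
      (*-monoʳ-∣ s (divides (m / N) refl)))) , (begin
    x                                   ≡⟨ []-toℕ x ⟨
    [ m ]                               ≡⟨ cong [_] (m≡m%n+[m/n]*n m N) ⟩
    [ m % N + m / N * N ]               ≡⟨ []-+ (m % N) (m / N * N) ⟩
    [ m % N ] ⊕ [ m / N * N ]           ≡⟨ cong (λ i → [ i ] ⊕ [ m / N * N ]) (toℕ-fromℕ< (m%n<n m N)) ⟨
    [ toℕ (rep x) ] ⊕ [ m / N * N ]     ∎)
    where
    open ≡-Reasoning
    m = toℕ x

  -- Multiplication by `s` kills `v` and takes numbers below `N` to numbers below `n`, where nothing
  -- is reduced.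
  representative-unique : ∀ {i j : Fin N} {v} → Torsion v → [ toℕ i ] ≡ [ toℕ j ] ⊕ v → i ≡ j
  representative-unique {i} {j} {v} sv≡e eq = toℕ-injective (*-cancelˡ-≡ (toℕ i) (toℕ j) s
    (trans (sym (small i)) (trans (cong toℕ scaled) (small j))))
    where
    small : ∀ (i : Fin N) → toℕ [ s * toℕ i ] ≡ s * toℕ i
    small i = trans (toℕ-[] (s * toℕ i)) (m<n⇒m%n≡m
      (subst (s * toℕ i <_) (sym n≡sN) (*-monoʳ-< s (toℕ<n i))))
    scaled : [ s * toℕ i ] ≡ [ s * toℕ j ]
    scaled = begin
      [ s * toℕ i ]                   ≡⟨ ·-[] s (toℕ i) ⟨
      s · [ toℕ i ]                   ≡⟨ cong (s ·_) eq ⟩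
      s · ([ toℕ j ] ⊕ v)             ≡⟨ ·-distrib-⊕ [ toℕ j ] v s ⟩
      (s · [ toℕ j ]) ⊕ (s · v)       ≡⟨ cong ((s · [ toℕ j ]) ⊕_) sv≡e ⟩
      (s · [ toℕ j ]) ⊕ e             ≡⟨ ⊕-identityʳ _ ⟩
      s · [ toℕ j ]                   ≡⟨ ·-[] s (toℕ j) ⟩
      [ s * toℕ j ]                   ∎
      where open ≡-Reasoning

  transversalSum : (C → C) → C
  transversalSum g = sum {N} λ j → g [ toℕ j ]

  -- A block-preserving bijection permutes the cosets, hence their representatives, and a periodic
  -- `g` sees only the coset.
  transversalSum-reindex : ∀ {g} (θ θ⁻¹ : C → C) → Periodic g → PreservesBlocks θ → PreservesBlocks θ⁻¹ →
    (∀ x → θ (θ⁻¹ x) ≡ x) → (∀ x → θ⁻¹ (θ x) ≡ x) →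
    transversalSum (λ x → g (θ x)) ≡ transversalSum g
  transversalSum-reindex {g} θ θ⁻¹ g-periodic θ-blocks θ⁻¹-blocks θθ⁻¹ θ⁻¹θ = sym (trans
    (sum-permute (λ j → g [ toℕ j ])
      (permutation (λ j → rep (θ [ toℕ j ])) (λ j → rep (θ⁻¹ [ toℕ j ]))
        (inverts θ⁻¹ θ θ-blocks θθ⁻¹) (inverts θ θ⁻¹ θ⁻¹-blocks θ⁻¹θ)))
    (sum-cong-≗ {N} λ j →
      let v , tv , eq = representative (θ [ toℕ j ])
      in sym (trans (cong g eq) (g-periodic _ tv))))
    where
    inverts : ∀ (α β : C → C) → PreservesBlocks β → (∀ x → β (α x) ≡ x) →
              ∀ j → rep (β [ toℕ (rep (α [ toℕ j ])) ]) ≡ j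
    inverts α β β-blocks βα j = sym (representative-unique (torsion-⊕ tv″ tv′) (begin
      [ toℕ j ]                          ≡⟨ βα [ toℕ j ] ⟨
      β (α [ toℕ j ])                    ≡⟨ cong β eq ⟩
      β ([ toℕ l ] ⊕ v)                  ≡⟨ eq′ ⟩
      β [ toℕ l ] ⊕ v′                   ≡⟨ cong (_⊕ v′) eq″ ⟩
      ([ toℕ (rep (β [ toℕ l ])) ] ⊕ v″) ⊕ v′ ≡⟨ ⊕-assoc _ v″ v′ ⟩
      [ toℕ (rep (β [ toℕ l ])) ] ⊕ (v″ ⊕ v′) ∎))
      where
      open ≡-Reasoning
      l = rep (α [ toℕ j ])
      v = proj₁ (representative (α [ toℕ j ]))
      tv = proj₁ (proj₂ (representative (α [ toℕ j ])))
      eq = proj₂ (proj₂ (representative (α [ toℕ j ])))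
      v′ = proj₁ (β-blocks [ toℕ l ] tv)
      tv′ = proj₁ (proj₂ (β-blocks [ toℕ l ] tv))
      eq′ = proj₂ (proj₂ (β-blocks [ toℕ l ] tv))
      v″ = proj₁ (representative (β [ toℕ l ]))
      tv″ = proj₁ (proj₂ (representative (β [ toℕ l ])))
      eq″ = proj₂ (proj₂ (representative (β [ toℕ l ])))

  torsion-sum : ∀ {l} (f : Fin l → C) → (∀ j → Torsion (f j)) → Torsion (sum f)
  torsion-sum {zero}  f tf = ·-e s
  torsion-sum {suc l} f tf = torsion-⊕ (tf Fin.zero) (torsion-sum (λ j → f (Fin.suc j)) (λ j → tf (Fin.suc j)))

  sum-homo : ∀ (m : C → C) → m e ≡ e → (∀ {v w} → Torsion v → Torsion w → m (v ⊕ w) ≡ m v ⊕ m w) →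
             ∀ {l} (f : Fin l → C) → (∀ j → Torsion (f j)) → sum (λ j → m (f j)) ≡ m (sum f)
  sum-homo m m-e m-⊕ {zero}  f tf = sym m-e
  sum-homo m m-e m-⊕ {suc l} f tf = trans
    (cong (m (f Fin.zero) ⊕_) (sum-homo m m-e m-⊕ (λ j → f (Fin.suc j)) (λ j → tf (Fin.suc j))))
    (sym (m-⊕ (tf Fin.zero) (torsion-sum (λ j → f (Fin.suc j)) (λ j → tf (Fin.suc j)))))

-- The permutation group of a skew morphism and its derived subgroup.

module SkewMorphism (n : ℕ) .{{_ : NonZero n}} (φ : Cyclic.C n → Cyclic.C n)
  (isSkew : Cyclic.IsSkewMorphism n φ) (k : ℕ) (isOrder : Cyclic.IsOrder n φ k) where
  open Cyclic n
  open CyclicGroup n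
  open Iterate n
  open Translation n
  open import Algebra.Properties.Group ⊕-group using (\\-leftDividesʳ; \\-leftDividesˡ)

  φ-e : φ e ≡ e
  φ-e = IsSkewMorphism.fixes-e isSkew

  π : C → ℕ
  π a = proj₁ (IsSkewMorphism.skew isSkew a)

  φ-⊕ : ∀ a b → φ (a ⊕ b) ≡ φ a ⊕ iter φ (π a) b
  φ-⊕ a = proj₂ (proj₂ (IsSkewMorphism.skew isSkew a))

  φᵏ≡id : ∀ x → iter φ k x ≡ x
  φᵏ≡id = proj₁ (proj₂ isOrder)

  φ-*k : ∀ i x → iter φ (i * k) x ≡ x
  φ-*k i x = trans (iter-* φ i k x) (iter-fixed (iter φ k) i (φᵏ≡id x))

  private
    instance
      k≢0 : NonZero k
      k≢0 = >-nonZero (proj₁ isOrder)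

  infix 30 _⁻
  -- An exponent for the inverse power: `i + i ⁻` is a multiple of the order `k`.
  _⁻ : ℕ → ℕ
  i ⁻ = i * (k ∸ 1)

  ⁻-sum : ∀ i → i + i ⁻ ≡ i * k
  ⁻-sum i = trans (sym (*-suc i (k ∸ 1))) (cong (i *_) (m+[n∸m]≡n (proj₁ isOrder)))

  iter-⁻ʳ : ∀ i x → iter φ i (iter φ (i ⁻) x) ≡ x
  iter-⁻ʳ i x = trans (sym (iter-+ φ i (i ⁻) x)) (trans (cong (λ j → iter φ j x) (⁻-sum i)) (φ-*k i x))

  iter-swap : ∀ i j x → iter φ i (iter φ j x) ≡ iter φ j (iter φ i x)
  iter-swap i j x = trans (sym (iter-+ φ i j x))
    (trans (cong (λ l → iter φ l x) (+-comm i j)) (iter-+ φ j i x))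

  iter-⁻ˡ : ∀ i x → iter φ (i ⁻) (iter φ i x) ≡ x
  iter-⁻ˡ i x = trans (iter-swap (i ⁻) i x) (iter-⁻ʳ i x)

  iter-e : ∀ i → iter φ i e ≡ e
  iter-e i = iter-fixed φ i φ-e

  period⇒∣ : ∀ i → (∀ x → iter φ i x ≡ x) → k ∣ i
  period⇒∣ i φⁱ≡id with i % k in eq
  ... | zero  = m%n≡0⇒n∣m i k eq
  ... | suc r = ⊥-elim (proj₂ (proj₂ isOrder) (suc r) (s≤s z≤n)
                  (subst (_< k) eq (m%n<n i k)) λ x → begin
    iter φ (suc r) x                        ≡⟨ cong (λ l → iter φ l x) eq ⟨
    iter φ (i % k) x                        ≡⟨ cong (iter φ (i % k)) (φ-*k (i / k) x) ⟨
    iter φ (i % k) (iter φ (i / k * k) x)   ≡⟨ iter-+ φ (i % k) (i / k * k) x ⟨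
    iter φ (i % k + i / k * k) x            ≡⟨ cong (λ l → iter φ l x) (m≡m%n+[m/n]*n i k) ⟨
    iter φ i x                              ≡⟨ φⁱ≡id x ⟩
    x                                       ∎)
    where open ≡-Reasoning

  iter-⊕ : ∀ i a → ∃ λ j → ∀ b → iter φ i (a ⊕ b) ≡ iter φ i a ⊕ iter φ j b
  iter-⊕ zero    a = 0 , λ b → refl
  iter-⊕ (suc i) a with iter-⊕ i a
  ... | j , eq = π (iter φ i a) + j , λ b → begin
    φ (iter φ i (a ⊕ b))                                         ≡⟨ cong φ (eq b) ⟩
    φ (iter φ i a ⊕ iter φ j b)                                  ≡⟨ φ-⊕ (iter φ i a) _ ⟩
    φ (iter φ i a) ⊕ iter φ (π (iter φ i a)) (iter φ j b)        ≡⟨ cong (φ (iter φ i a) ⊕_) (iter-+ φ (π (iter φ i a)) j b) ⟨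
    φ (iter φ i a) ⊕ iter φ (π (iter φ i a) + j) b               ∎
    where open ≡-Reasoning

  φ^ : ℕ → Permutation′ n
  φ^ i = permutation (iter φ i) (iter φ (i ⁻)) (iter-⁻ʳ i) (iter-⁻ˡ i)

  -- Obtained by inverting both sides of `iter-⊕` for the exponent `i ⁻` and the element `⊖ a`.
  translation-φ^ : ∀ a i → ∃₂ λ j b → ∀ x → a ⊕ iter φ i x ≡ iter φ j (b ⊕ x)
  translation-φ^ a i with iter-⊕ (i ⁻) (⊖ a)
  ... | j , eq = j ⁻ , ⊖ u , λ x → begin
    a ⊕ iter φ i x                                        ≡⟨ iter-⁻ˡ j _ ⟨
    iter φ (j ⁻) (iter φ j (a ⊕ iter φ i x))              ≡⟨ cong (iter φ (j ⁻)) (\\-leftDividesʳ u _) ⟨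
    iter φ (j ⁻) (⊖ u ⊕ (u ⊕ iter φ j (a ⊕ iter φ i x)))  ≡⟨ cong (λ t → iter φ (j ⁻) (⊖ u ⊕ t)) (eq (a ⊕ iter φ i x)) ⟨
    iter φ (j ⁻) (⊖ u ⊕ iter φ (i ⁻) (⊖ a ⊕ (a ⊕ iter φ i x))) ≡⟨ cong (λ t → iter φ (j ⁻) (⊖ u ⊕ iter φ (i ⁻) t)) (\\-leftDividesʳ a _) ⟩
    iter φ (j ⁻) (⊖ u ⊕ iter φ (i ⁻) (iter φ i x))        ≡⟨ cong (λ t → iter φ (j ⁻) (⊖ u ⊕ t)) (iter-⁻ˡ i x) ⟩
    iter φ (j ⁻) (⊖ u ⊕ x)                                ∎
    where
    open ≡-Reasoning
    u = iter φ (i ⁻) (⊖ a)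

  ⊕-swap : ∀ a b x → a ⊕ (b ⊕ x) ≡ b ⊕ (a ⊕ x)
  ⊕-swap a b x = trans (sym (⊕-assoc a b x)) (trans (cong (_⊕ x) (⊕-comm a b)) (⊕-assoc b a x))

  open Commutators translation φ^ ⊕-swap iter-swap
    (λ a → ⊖ a , λ x → refl) (λ i → i ⁻ , λ x → refl)
    translation-φ^ (λ i a → iter φ i a , iter-⊕ i a)

  -- The elements whose power function value is 1, given by an equation because `π` is only some
  -- admissible exponent.
  Kernel : C → Set
  Kernel a = ∀ b → φ (a ⊕ b) ≡ φ a ⊕ φ b

  private module D = NormalAbelian n Derived identity compose inverse derived-commute derived-conjugateᴬ

  -- The commutator of the translation by `a` with `φ` carries `φ a` to `a`, as `φ` fixes `e`. Its
  -- inverse carries `a` to `φ a`, and conjugation by the translation by `⊖ a` moves this to `e`.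
  displacement-orbit : ∀ a → D.InOrbit (⊖ a ⊕ φ a)
  displacement-orbit a = g⁻¹ D.at (⊖ a) , (begin
    g⁻¹ D.at (⊖ a) D.▸ e                  ≡⟨ cong (g⁻¹ D.at (⊖ a) D.▸_) (⊕-inverseˡ a) ⟨
    g⁻¹ D.at (⊖ a) D.▸ ⊖ a ⊕ a            ≡⟨ D.at-▸ g⁻¹ (⊖ a) a ⟩
    ⊖ a ⊕ (g⁻¹ D.▸ a)                     ≡⟨ cong (λ t → ⊖ a ⊕ (flip g ⟨$⟩ʳ t)) g▸φa≡a ⟨
    ⊖ a ⊕ (flip g ⟨$⟩ʳ (g ⟨$⟩ʳ φ a))      ≡⟨ cong (⊖ a ⊕_) (inverseˡ g) ⟩
    ⊖ a ⊕ φ a                             ∎)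
    where
    open ≡-Reasoning
    g : Permutation′ n
    g = (translation a ↔-∘ φ^ 1) ↔-∘ (flip (translation a) ↔-∘ flip (φ^ 1))
    g-commutator : IsCommutator a 1 g
    g-commutator x = cong (λ t → a ⊕ φ t) (trans (cong (⊖ a ⊕_) (iter-⁻ˡ 1 (a ⊕ x))) (\\-leftDividesʳ a x))
    g⁻¹ : D.Element
    g⁻¹ = flip g , inverse (commutator a 1 g-commutator)
    g▸φa≡a : g ⟨$⟩ʳ φ a ≡ a
    g▸φa≡a = trans (cong (λ t → g ⟨$⟩ʳ φ t) (sym (⊕-identityʳ a)))
      (trans (g-commutator e) (trans (cong (a ⊕_) φ-e) (⊕-identityʳ a)))

  ReachableFrom : ℕ → ℕ → Set
  ReachableFrom i t = ∃ λ a → ∀ x → iter φ t x ≡ iter φ (a * i) x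

  reachable-ideal : ∀ i → IsIdeal (ReachableFrom i)
  reachable-ideal i = record
    { add = λ { {u} {v} (a , p) (b , q) → a + b , λ x → begin
        iter φ (u + v) x                          ≡⟨ iter-+ φ u v x ⟩
        iter φ u (iter φ v x)                     ≡⟨ p _ ⟩
        iter φ (a * i) (iter φ v x)               ≡⟨ cong (iter φ (a * i)) (q x) ⟩
        iter φ (a * i) (iter φ (b * i) x)         ≡⟨ iter-+ φ (a * i) (b * i) x ⟨
        iter φ (a * i + b * i) x                  ≡⟨ cong (λ l → iter φ l x) (*-distribʳ-+ i a b) ⟨
        iter φ ((a + b) * i) x                    ∎ }
    -- The witness represents `a` minus `b`, since `k ∸ 1` acts as minus one on exponents.
    ; sub = λ { {u} {v} (a , p) (b , q) → (k ∸ 1) * b + a , λ x → begin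
        iter φ v x                                                ≡⟨ iter-⁻ˡ (b * i) _ ⟨
        iter φ ((b * i) ⁻) (iter φ (b * i) (iter φ v x))          ≡⟨ cong (iter φ ((b * i) ⁻)) (q _) ⟨
        iter φ ((b * i) ⁻) (iter φ u (iter φ v x))                ≡⟨ cong (iter φ ((b * i) ⁻)) (iter-+ φ u v x) ⟨
        iter φ ((b * i) ⁻) (iter φ (u + v) x)                     ≡⟨ cong (iter φ ((b * i) ⁻)) (p x) ⟩
        iter φ ((b * i) ⁻) (iter φ (a * i) x)                     ≡⟨ iter-+ φ ((b * i) ⁻) (a * i) x ⟨
        iter φ ((b * i) ⁻ + a * i) x                              ≡⟨ cong (λ l → iter φ (l + a * i) x)
                                                                      (trans (*-comm (b * i) (k ∸ 1)) (sym (*-assoc (k ∸ 1) b i))) ⟩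
        iter φ ((k ∸ 1) * b * i + a * i) x                        ≡⟨ cong (λ l → iter φ l x) (*-distribʳ-+ i ((k ∸ 1) * b) a) ⟨
        iter φ (((k ∸ 1) * b + a) * i) x                          ∎ } }
    where open ≡-Reasoning

  -- In the cyclic group ⟨φ⟩ every nontrivial element of order s generates all elements of order dividing s.
  prime-order-reachable : ∀ {s i j} → Prime s →
    (∀ x → iter φ (s * i) x ≡ x) → (∀ x → iter φ (s * j) x ≡ x) →
    (∀ x → iter φ i x ≡ x) ⊎ ReachableFrom i j
  prime-order-reachable {s} {i} {j} s-prime φˢⁱ≡id φˢʲ≡id = conclude (gcd[m,n]∣n i k)
    where
    instance
      s≢0 : NonZero s
      s≢0 = prime⇒nonZero s-prime
    g = gcd i k
    k∣sg : k ∣ s * g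
    k∣sg = subst (k ∣_) (sym (c*gcd[m,n]≡gcd[cm,cn] s i k))
      (gcd-greatest (period⇒∣ (s * i) φˢⁱ≡id) (n∣m*n s))
    -- The quotient `q` of `k` by `g` divides `s`. If it is 1, then `k` divides `i`. If it is `s`,
    -- then `g` divides `j`, and Bézout reaches the `g`-th power from the `i`-th.
    conclude : g ∣ k → (∀ x → iter φ i x ≡ x) ⊎ ReachableFrom i j
    conclude (divides q k≡qg)
      with prime⇒irreducible s-prime (*-cancelʳ-∣ {q} {s} g {{m*n≢0⇒n≢0 q {{subst NonZero k≡qg k≢0}}}} (subst (_∣ s * g) k≡qg k∣sg))
    ... | inj₁ q≡1 = inj₁ λ x → φⁱ≡id (subst (_∣ i) (sym (trans k≡qg (trans (cong (_* g) q≡1) (*-identityˡ g)))) (gcd[m,n]∣m i k)) x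
      where
      φⁱ≡id : k ∣ i → ∀ x → iter φ i x ≡ x
      φⁱ≡id (divides l i≡lk) x = trans (cong (λ t → iter φ t x) i≡lk) (φ-*k l x)
    ... | inj₂ q≡s = inj₂ (multiple (*-cancelˡ-∣ s (subst (_∣ s * j) (trans k≡qg (cong (_* g) q≡s)) (period⇒∣ (s * j) φˢʲ≡id))))
      where
      multiple : g ∣ j → ReachableFrom i j
      multiple (divides l j≡lg) = subst (ReachableFrom i) (sym j≡lg)
        (IsIdeal.mul (reachable-ideal i) l (IsIdeal.has-gcd (reachable-ideal i) i k
          (1 , λ x → cong (λ t → iter φ t x) (sym (*-identityˡ i))) (0 , φᵏ≡id)))

  -- Skew morphisms affine on the cosets of the torsion subgroup.

  module Affine {s N : ℕ} (s-prime : Prime s) (n≡sN : n ≡ s * N) (s⊥N : Coprime s N)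
    (φ-blocks : Transversal.PreservesBlocks n s-prime n≡sN φ)
    (φ-affine : ∀ x {v w v′} → s · v ≡ e → s · w ≡ e → s · v′ ≡ e →
                φ (x ⊕ v) ≡ φ x ⊕ v′ → φ ((x ⊕ w) ⊕ v) ≡ φ (x ⊕ w) ⊕ v′)
    where

    open Transversal n s-prime n≡sN
    open import Algebra.Properties.CommutativeMonoid.Sum ⊕-commutativeMonoid
      using (sum; sum-cong-≗; ∑-distrib-+; sum-replicate)

    -- For torsion `w` this is the linear part of `φ` on the coset of `x`.
    slope : C → C → C
    slope x w = ⊖ φ x ⊕ φ (x ⊕ w)

    φ-slope : ∀ x w → φ (x ⊕ w) ≡ φ x ⊕ slope x w
    φ-slope x w = sym (\\-leftDividesˡ (φ x) _)

    slope-unique : ∀ {x w v} → φ (x ⊕ w) ≡ φ x ⊕ v → slope x w ≡ v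
    slope-unique {x} eq = trans (cong (⊖ φ x ⊕_) eq) (\\-leftDividesʳ (φ x) _)

    slope-torsion : ∀ x {w} → Torsion w → Torsion (slope x w)
    slope-torsion x tw = let v , tv , eq = φ-blocks x tw in subst Torsion (sym (slope-unique eq)) tv

    slope-periodic : ∀ {v} → Torsion v → Periodic (λ x → slope x v)
    slope-periodic tv x tw = slope-unique (φ-affine x tv tw (slope-torsion x tv) (φ-slope x _))

    slope-e : ∀ x → slope x e ≡ e
    slope-e x = slope-unique (trans (cong φ (⊕-identityʳ x)) (sym (⊕-identityʳ (φ x))))

    slope-⊕ : ∀ x {v w} → Torsion v → Torsion w → slope x (v ⊕ w) ≡ slope x v ⊕ slope x w
    slope-⊕ x {v} {w} tv tw = slope-unique (begin
      φ (x ⊕ (v ⊕ w))                     ≡⟨ cong φ (⊕-assoc x v w) ⟨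
      φ ((x ⊕ v) ⊕ w)                     ≡⟨ φ-slope (x ⊕ v) w ⟩
      φ (x ⊕ v) ⊕ slope (x ⊕ v) w         ≡⟨ cong₂ _⊕_ (φ-slope x v) (slope-periodic tw x tv) ⟩
      (φ x ⊕ slope x v) ⊕ slope x w       ≡⟨ ⊕-assoc _ _ _ ⟩
      φ x ⊕ (slope x v ⊕ slope x w)       ∎)
      where open ≡-Reasoning

    slope-· : ∀ x i {v} → Torsion v → slope x (i · v) ≡ i · slope x v
    slope-· x zero    tv = slope-e x
    slope-· x (suc i) tv = trans (slope-⊕ x tv (torsion-· i tv)) (cong (slope x _ ⊕_) (slope-· x i tv))

    iter-blocks : ∀ i → PreservesBlocks (iter φ i)
    iter-blocks zero    x {w} tw = w , tw , refl
    iter-blocks (suc i) x tw =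
      let v , tv , eq = iter-blocks i x tw
          v′ , tv′ , eq′ = φ-blocks (iter φ i x) tv
      in v′ , tv′ , trans (cong φ eq) eq′

    module _ (j : ℕ) {d : C → C} (φʲ≡ : ∀ x → iter φ j x ≡ x ⊕ d x)
             (d-torsion : ∀ x → Torsion (d x)) (d-periodic : Periodic d) where

      -- The iterates of `x` stay in one coset, where `d` is constant, so the displacements add up.
      iterate-displacement : ∀ t x → iter (iter φ j) t x ≡ x ⊕ (t · d x)
      iterate-displacement zero    x = sym (⊕-identityʳ x)
      iterate-displacement (suc t) x = begin
        iter φ j (iter (iter φ j) t x)               ≡⟨ cong (iter φ j) (iterate-displacement t x) ⟩
        iter φ j (x ⊕ (t · d x))                     ≡⟨ φʲ≡ _ ⟩
        (x ⊕ (t · d x)) ⊕ d (x ⊕ (t · d x))          ≡⟨ cong ((x ⊕ (t · d x)) ⊕_) (d-periodic x (torsion-· t (d-torsion x))) ⟩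
        (x ⊕ (t · d x)) ⊕ d x                        ≡⟨ ⊕-assoc x _ _ ⟩
        x ⊕ ((t · d x) ⊕ d x)                        ≡⟨ cong (x ⊕_) (⊕-comm (t · d x) (d x)) ⟩
        x ⊕ (d x ⊕ (t · d x))                        ∎
        where open ≡-Reasoning

      displacement-period : ∀ x → iter φ (s * j) x ≡ x
      displacement-period x = trans (iter-* φ s j x) (trans (iterate-displacement s x)
        (trans (cong (x ⊕_) (d-torsion x)) (⊕-identityʳ x)))

    module _ {c : C} (tc : Torsion c) where

      -- The permutation y ↦ φ (c ⊕ φ⁻¹ y), up to the translation by φ c, fixes e, hence is a power φⁱ of φ.
      private
        i : ℕ
        i = π c + 1 ⁻

      -- It vanishes identically exactly when `c` lies in the kernel.
      f : C → C
      f y = ⊖ y ⊕ iter φ i y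

      φⁱ≡ : ∀ y → iter φ i y ≡ y ⊕ f y
      φⁱ≡ y = sym (\\-leftDividesˡ y _)

      f-e : f e ≡ e
      f-e = trans (cong (⊖ e ⊕_) (iter-e i)) (⊕-inverseˡ e)

      φⁱφ≡ : ∀ b → iter φ i (φ b) ≡ iter φ (π c) b
      φⁱφ≡ b = trans (iter-+ φ (π c) (1 ⁻) (φ b)) (cong (iter φ (π c)) (iter-⁻ˡ 1 b))

      -- Two evaluations of `φ (b ⊕ c)`: along the coset of `b`, and by the skew identity at `c`.
      -- Through them `f` inherits torsion values and periodicity from the slopes.
      slope-c : ∀ b → slope b c ≡ φ c ⊕ f (φ b)
      slope-c b = slope-unique (begin
        φ (b ⊕ c)                         ≡⟨ cong φ (⊕-comm b c) ⟩
        φ (c ⊕ b)                         ≡⟨ φ-⊕ c b ⟩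
        φ c ⊕ iter φ (π c) b              ≡⟨ cong (φ c ⊕_) (φⁱφ≡ b) ⟨
        φ c ⊕ iter φ i (φ b)              ≡⟨ cong (φ c ⊕_) (φⁱ≡ (φ b)) ⟩
        φ c ⊕ (φ b ⊕ f (φ b))             ≡⟨ ⊕-swap (φ c) (φ b) _ ⟩
        φ b ⊕ (φ c ⊕ f (φ b))             ∎)
        where open ≡-Reasoning

      slope-e-c : slope e c ≡ φ c
      slope-e-c = trans (slope-c e) (trans (cong (λ t → φ c ⊕ f t) φ-e)
        (trans (cong (φ c ⊕_) f-e) (⊕-identityʳ (φ c))))

      φ-surjective : (P : C → Set) → (∀ b → P (φ b)) → ∀ y → P y
      φ-surjective P p y = subst P (iter-⁻ʳ 1 y) (p (iter φ (1 ⁻) y))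

      f-torsion : ∀ y → Torsion (f y)
      f-torsion = φ-surjective (λ y → Torsion (f y)) λ b → torsion-cancel (φ c)
        (subst Torsion (slope-c b) (slope-torsion b tc)) (subst Torsion slope-e-c (slope-torsion e tc))

      f-periodic : Periodic f
      f-periodic y {v} tv = ⊕-cancelˡ (φ c) (begin
        φ c ⊕ f (y ⊕ v)                  ≡⟨ cong (λ t → φ c ⊕ f t) (iter-⁻ʳ 1 (y ⊕ v)) ⟨
        φ c ⊕ f (φ (iter φ (1 ⁻) (y ⊕ v))) ≡⟨ slope-c _ ⟨
        slope (iter φ (1 ⁻) (y ⊕ v)) c   ≡⟨ cong (λ t → slope t c) eq ⟩
        slope (iter φ (1 ⁻) y ⊕ v′) c    ≡⟨ slope-periodic tc _ tv′ ⟩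
        slope (iter φ (1 ⁻) y) c         ≡⟨ slope-c _ ⟩
        φ c ⊕ f (φ (iter φ (1 ⁻) y))     ≡⟨ cong (λ t → φ c ⊕ f t) (iter-⁻ʳ 1 y) ⟩
        φ c ⊕ f y                        ∎)
        where
        open ≡-Reasoning
        v′ = proj₁ (iter-blocks (1 ⁻) y tv)
        tv′ = proj₁ (proj₂ (iter-blocks (1 ⁻) y tv))
        eq = proj₂ (proj₂ (iter-blocks (1 ⁻) y tv))

      -- The skew identity at `a` is applied to `iter φ i y` for `y` the difference of `x` and `a`.
      -- As powers of `φ` commute, `iter φ i` can act last, which exhibits its displacement at
      -- `⊖ φ a ⊕ φ x`.
      slope-f : ∀ a x → f (⊖ φ a ⊕ φ x) ≡ slope x (f (⊖ a ⊕ x))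
      slope-f a x = sym (slope-unique (begin
        φ (x ⊕ f y)                                   ≡⟨ cong (λ t → φ (t ⊕ f y)) (\\-leftDividesˡ a x) ⟨
        φ ((a ⊕ y) ⊕ f y)                             ≡⟨ cong φ (⊕-assoc a y (f y)) ⟩
        φ (a ⊕ (y ⊕ f y))                             ≡⟨ cong (λ t → φ (a ⊕ t)) (φⁱ≡ y) ⟨
        φ (a ⊕ iter φ i y)                            ≡⟨ φ-⊕ a _ ⟩
        φ a ⊕ iter φ (π a) (iter φ i y)               ≡⟨ cong (φ a ⊕_) (iter-swap (π a) i y) ⟩
        φ a ⊕ iter φ i (iter φ (π a) y)               ≡⟨ cong (φ a ⊕_) (φⁱ≡ _) ⟩
        φ a ⊕ (iter φ (π a) y ⊕ f (iter φ (π a) y))   ≡⟨ ⊕-assoc (φ a) _ _ ⟨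
        (φ a ⊕ iter φ (π a) y) ⊕ f (iter φ (π a) y)   ≡⟨ cong₂ (λ t t′ → t ⊕ f t′) φx≡ z≡ ⟩
        φ x ⊕ f (⊖ φ a ⊕ φ x)                         ∎))
        where
        open ≡-Reasoning
        y = ⊖ a ⊕ x
        φx≡ : φ a ⊕ iter φ (π a) y ≡ φ x
        φx≡ = trans (sym (φ-⊕ a y)) (cong φ (\\-leftDividesˡ a x))
        z≡ : iter φ (π a) y ≡ ⊖ φ a ⊕ φ x
        z≡ = trans (sym (\\-leftDividesʳ (φ a) _)) (cong (⊖ φ a ⊕_) φx≡)

      private
        F : C
        F = transversalSum f

        F-torsion : Torsion F
        F-torsion = torsion-sum (λ (j : Fin N) → f [ toℕ j ]) (λ j → f-torsion _)

        reflection : C → C → C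
        reflection d t = ⊖ t ⊕ d

        reflection-involutive : ∀ d t → reflection d (reflection d t) ≡ t
        reflection-involutive d t = ⊕-cancelˡ (reflection d t)
          (trans (\\-leftDividesˡ (reflection d t) d) (trans (sym (\\-leftDividesˡ t d)) (⊕-comm t _)))

        reflection-blocks : ∀ d → PreservesBlocks (reflection d)
        reflection-blocks d t {w} tw = ⊖ w , torsion-⊖ tw ,
          (begin
          ⊖ (t ⊕ w) ⊕ d          ≡⟨ cong (_⊕ d) (⁻¹-∙-comm t w) ⟨
          (⊖ t ⊕ ⊖ w) ⊕ d        ≡⟨ ⊕-assoc (⊖ t) (⊖ w) d ⟩
          ⊖ t ⊕ (⊖ w ⊕ d)        ≡⟨ cong (⊖ t ⊕_) (⊕-comm (⊖ w) d) ⟩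
          ⊖ t ⊕ (d ⊕ ⊖ w)        ≡⟨ ⊕-assoc (⊖ t) d (⊖ w) ⟨
          (⊖ t ⊕ d) ⊕ ⊖ w        ∎)
          where
          open ≡-Reasoning
          open import Algebra.Properties.AbelianGroup ⊕-abelianGroup using (⁻¹-∙-comm)

        f-reflection-periodic : ∀ d → Periodic (λ t → f (reflection d t))
        f-reflection-periodic d t tw =
          let v , tv , eq = reflection-blocks d t tw in trans (cong f eq) (f-periodic _ tv)

        sum-reflection : ∀ d → transversalSum (λ t → f (reflection d t)) ≡ F
        sum-reflection d = transversalSum-reindex (reflection d) (reflection d) f-periodic
          (reflection-blocks d) (reflection-blocks d) (reflection-involutive d) (reflection-involutive d)

      -- `slope-f` is summed over `a` in the transversal. Since reflections and `φ` permute the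
      -- cosets, one side becomes `slope x F` and the other `F`.
      slope-F : ∀ x → slope x F ≡ F
      slope-F x = begin
        slope x F                                                    ≡⟨ cong (slope x) (sum-reflection x) ⟨
        slope x (transversalSum (λ t → f (⊖ t ⊕ x)))                 ≡⟨ sum-homo (slope x) (slope-e x) (slope-⊕ x)
                                                                          (λ (j : Fin N) → f (⊖ [ toℕ j ] ⊕ x)) (λ j → f-torsion _) ⟨
        transversalSum (λ t → slope x (f (⊖ t ⊕ x)))                 ≡⟨ sum-cong-≗ {N} (λ j → slope-f [ toℕ j ] x) ⟨
        transversalSum (λ t → f (⊖ φ t ⊕ φ x))                       ≡⟨ transversalSum-reindex φ (iter φ (1 ⁻)) (f-reflection-periodic (φ x))
                                                                          φ-blocks (iter-blocks (1 ⁻)) (iter-⁻ʳ 1) (iter-⁻ˡ 1) ⟩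
        transversalSum (λ t → f (⊖ t ⊕ φ x))                         ≡⟨ sum-reflection (φ x) ⟩
        F                                                            ∎
        where open ≡-Reasoning

      -- A nontrivial `F` generates the torsion, so every slope fixes `c`. Then `slope b c` equals
      -- `slope e c`, which is `φ c`, and `slope-c` leaves `f (φ b) ≡ e`.
      F≢e⇒f≡e : F ≢ e → ∀ y → f y ≡ e
      F≢e⇒f≡e F≢e = φ-surjective (λ y → f y ≡ e) λ b → ⊕-cancelˡ (φ c)
        (trans (sym (slope-c b)) (trans (slope≡c b) (trans (sym (slope≡c e))
          (trans slope-e-c (sym (⊕-identityʳ (φ c)))))))
        where
        m = proj₁ (torsion-cyclic n s-prime n≡sN F≢e F-torsion tc)
        c≡mF = proj₂ (torsion-cyclic n s-prime n≡sN F≢e F-torsion tc)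
        slope≡c : ∀ x → slope x c ≡ c
        slope≡c x = trans (cong (slope x) c≡mF) (trans (slope-· x (toℕ m) F-torsion)
          (trans (cong (toℕ m ·_) (slope-F x)) (sym c≡mF)))

      -- Moving the `i`-th power of `φ` past the translation by `[ 1 ]` yields a `j`-th power with
      -- displacement `d`. Both powers have order dividing `s`, so either the first is trivial or
      -- the second is its `a`-th power, of displacement `a · f x`.
      f-recurrence : (∀ y → f y ≡ e) ⊎ ∃ λ a → ∀ x → f ([ 1 ] ⊕ x) ≡ f [ 1 ] ⊕ (a · f x)
      f-recurrence = conclude (prime-order-reachable s-prime
        (displacement-period i φⁱ≡ f-torsion f-periodic) (displacement-period j φʲ≡ d-torsion d-periodic))
        where
        b = f [ 1 ]
        j = proj₁ (iter-⊕ i [ 1 ])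
        d : C → C
        d x = ⊖ b ⊕ f ([ 1 ] ⊕ x)
        φʲ≡ : ∀ x → iter φ j x ≡ x ⊕ d x
        φʲ≡ x = ⊕-cancelˡ ([ 1 ] ⊕ b) (begin
          ([ 1 ] ⊕ b) ⊕ iter φ j x                  ≡⟨ cong (_⊕ iter φ j x) (φⁱ≡ [ 1 ]) ⟨
          iter φ i [ 1 ] ⊕ iter φ j x               ≡⟨ proj₂ (iter-⊕ i [ 1 ]) x ⟨
          iter φ i ([ 1 ] ⊕ x)                      ≡⟨ φⁱ≡ ([ 1 ] ⊕ x) ⟩
          ([ 1 ] ⊕ x) ⊕ f ([ 1 ] ⊕ x)               ≡⟨ cong (([ 1 ] ⊕ x) ⊕_) (\\-leftDividesˡ b _) ⟨
          ([ 1 ] ⊕ x) ⊕ (b ⊕ d x)                   ≡⟨ ⊕-assoc [ 1 ] x _ ⟩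
          [ 1 ] ⊕ (x ⊕ (b ⊕ d x))                   ≡⟨ cong ([ 1 ] ⊕_) (⊕-swap x b (d x)) ⟩
          [ 1 ] ⊕ (b ⊕ (x ⊕ d x))                   ≡⟨ ⊕-assoc [ 1 ] b _ ⟨
          ([ 1 ] ⊕ b) ⊕ (x ⊕ d x)                   ∎)
          where open ≡-Reasoning
        d-torsion : ∀ x → Torsion (d x)
        d-torsion x = torsion-⊕ (torsion-⊖ (f-torsion [ 1 ])) (f-torsion _)
        d-periodic : Periodic d
        d-periodic x {v} tv = cong (⊖ b ⊕_) (trans (cong f (sym (⊕-assoc [ 1 ] x v))) (f-periodic _ tv))
        conclude : (∀ x → iter φ i x ≡ x) ⊎ ReachableFrom i j →
                   (∀ y → f y ≡ e) ⊎ ∃ λ a → ∀ x → f ([ 1 ] ⊕ x) ≡ b ⊕ (a · f x)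
        conclude (inj₁ φⁱ≡id) = inj₁ λ y → trans (cong (⊖ y ⊕_) (φⁱ≡id y)) (⊕-inverseˡ y)
        conclude (inj₂ (a , φʲ≡φᵃⁱ)) = inj₂ (a , λ x → trans (sym (\\-leftDividesˡ b _)) (cong (b ⊕_)
          (⊕-cancelˡ x (trans (sym (φʲ≡ x)) (trans (φʲ≡φᵃⁱ x) (trans (iter-* φ a i x)
            (iterate-displacement i φⁱ≡ f-torsion f-periodic a x)))))))

      -- Summation over the transversal turns the recurrence into `F ≡ (N · f [ 1 ]) ⊕ (a · F)`. So
      -- `f [ 1 ]` is annihilated by `N` as well as by the coprime `s`, and induction along the
      -- multiples of `[ 1 ]` does the rest.
      recurrence⇒f≡e : F ≡ e → ∀ a → (∀ x → f ([ 1 ] ⊕ x) ≡ f [ 1 ] ⊕ (a · f x)) → ∀ y → f y ≡ e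
      recurrence⇒f≡e F≡e a rec y = trans (cong f (sym ([]-toℕ y))) (vanish (toℕ y))
        where
        open ≡-Reasoning
        b = f [ 1 ]
        shift-blocks : ∀ t → PreservesBlocks (t ⊕_)
        shift-blocks t x {w} tw = w , tw , sym (⊕-assoc t x w)
        Nb≡e : N · b ≡ e
        Nb≡e = begin
          N · b                                                         ≡⟨ ⊕-identityʳ _ ⟨
          (N · b) ⊕ e                                                   ≡⟨ cong ((N · b) ⊕_) (trans (cong (a ·_) F≡e) (·-e a)) ⟨
          (N · b) ⊕ (a · F)                                             ≡⟨ cong₂ _⊕_ (sum-replicate N)
                                                                             (sum-homo (a ·_) (·-e a) (λ {v} {w} _ _ → ·-distrib-⊕ v w a)
                                                                               (λ (j : Fin N) → f [ toℕ j ]) (λ j → f-torsion _)) ⟨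
          transversalSum (λ _ → b) ⊕ transversalSum (λ x → a · f x)     ≡⟨ ∑-distrib-+ {N} (λ _ → b) (λ j → a · f [ toℕ j ]) ⟨
          transversalSum (λ x → b ⊕ (a · f x))                          ≡⟨ sum-cong-≗ {N} (λ j → rec [ toℕ j ]) ⟨
          transversalSum (λ x → f ([ 1 ] ⊕ x))                          ≡⟨ transversalSum-reindex ([ 1 ] ⊕_) (⊖ [ 1 ] ⊕_) f-periodic
                                                                             (shift-blocks [ 1 ]) (shift-blocks (⊖ [ 1 ]))
                                                                             (\\-leftDividesˡ [ 1 ]) (\\-leftDividesʳ [ 1 ]) ⟩
          F                                                             ≡⟨ F≡e ⟩
          e                                                             ∎
        b≡e : b ≡ e
        b≡e = coprime-annihilators s⊥N (f-torsion [ 1 ]) Nb≡e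
        vanish : ∀ m → f [ m ] ≡ e
        vanish zero    = f-e
        vanish (suc m) = begin
          f [ 1 + m ]                ≡⟨ cong f ([]-+ 1 m) ⟩
          f ([ 1 ] ⊕ [ m ])          ≡⟨ rec [ m ] ⟩
          b ⊕ (a · f [ m ])          ≡⟨ cong₂ (λ t t′ → t ⊕ (a · t′)) b≡e (vanish m) ⟩
          e ⊕ (a · e)                ≡⟨ trans (⊕-identityˡ _) (·-e a) ⟩
          e                          ∎

      f≡e : ∀ y → f y ≡ e
      f≡e = conclude (F ≟ e) f-recurrence
        where
        conclude : Dec (F ≡ e) → (∀ y → f y ≡ e) ⊎ (∃ λ a → ∀ x → f ([ 1 ] ⊕ x) ≡ f [ 1 ] ⊕ (a · f x)) →
                   ∀ y → f y ≡ e
        conclude (no F≢e)  _              = F≢e⇒f≡e F≢e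
        conclude (yes _)   (inj₁ f≡e)     = f≡e
        conclude (yes F≡e) (inj₂ (a , r)) = recurrence⇒f≡e F≡e a r

      torsion⊆kernel : Kernel c
      torsion⊆kernel b = trans (φ-⊕ c b) (cong (φ c ⊕_) (trans (sym (φⁱφ≡ b))
        (trans (φⁱ≡ (φ b)) (trans (cong (φ b ⊕_) (f≡e (φ b))) (⊕-identityʳ (φ b))))))

  -- The kernel and the combination of the three primes.

  kernel-e : Kernel e
  kernel-e b = trans (cong φ (⊕-identityˡ b)) (trans (sym (⊕-identityˡ (φ b))) (cong (_⊕ φ b) (sym φ-e)))

  kernel-⊕ : ∀ {a b} → Kernel a → Kernel b → Kernel (a ⊕ b)
  kernel-⊕ {a} {b} p q x = begin
    φ ((a ⊕ b) ⊕ x)          ≡⟨ cong φ (⊕-assoc a b x) ⟩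
    φ (a ⊕ (b ⊕ x))          ≡⟨ p _ ⟩
    φ a ⊕ φ (b ⊕ x)          ≡⟨ cong (φ a ⊕_) (q x) ⟩
    φ a ⊕ (φ b ⊕ φ x)        ≡⟨ ⊕-assoc _ _ _ ⟨
    (φ a ⊕ φ b) ⊕ φ x        ≡⟨ cong (_⊕ φ x) (p b) ⟨
    φ (a ⊕ b) ⊕ φ x          ∎
    where open ≡-Reasoning

  kernel-cancel : ∀ {a b} → Kernel (a ⊕ b) → Kernel a → Kernel b
  kernel-cancel {a} {b} p q x = ⊕-cancelˡ (φ a) (begin
    φ a ⊕ φ (b ⊕ x)          ≡⟨ q _ ⟨
    φ (a ⊕ (b ⊕ x))          ≡⟨ cong φ (⊕-assoc a b x) ⟨
    φ ((a ⊕ b) ⊕ x)          ≡⟨ p x ⟩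
    φ (a ⊕ b) ⊕ φ x          ≡⟨ cong (_⊕ φ x) (q b) ⟩
    (φ a ⊕ φ b) ⊕ φ x        ≡⟨ ⊕-assoc _ _ _ ⟩
    φ a ⊕ (φ b ⊕ φ x)        ∎)
    where open ≡-Reasoning

  kernel-ideal : ∀ y → IsIdeal (λ t → Kernel (t · y))
  kernel-ideal y = record
    { add = λ {u} {v} p q → subst Kernel (sym (·-homo-+ y u v)) (kernel-⊕ p q)
    ; sub = λ {u} {v} p q → kernel-cancel {u · y} (subst Kernel (·-homo-+ y u v) p) q }

  module _ {s N : ℕ} (s-prime : Prime s) (n≡sN : n ≡ s * N) (s⊥N : Coprime s N) where

    orbit-torsion⊆kernel : ∀ {c} → D.InOrbit c → s · c ≡ e → Kernel c
    orbit-torsion⊆kernel {c} c-orbit sc≡e = conclude (c ≟ e)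
      where
      factor : ∃₂ λ l o → n ! ≡ s ℕ.^ l * o × Coprime s o
      factor = prime-power-factor s-prime (n !) {{ n !≢0 }}

      open PrimaryPart n Derived identity compose inverse derived-commute derived-conjugateᴬ
        s-prime n≡sN s⊥N {proj₁ factor} (proj₁ (proj₂ (proj₂ factor))) (proj₂ (proj₂ (proj₂ factor)))

      conclude : Dec (c ≡ e) → Kernel c
      conclude (yes c≡e) = subst Kernel (sym c≡e) kernel-e
      conclude (no c≢e)  = Affine.torsion⊆kernel s-prime n≡sN s⊥N
        (torsion-block c-orbit sc≡e c≢e (φ^ 1) (derived-conjugateᴮ 1))
        (torsion-affine c-orbit sc≡e c≢e (φ^ 1) (derived-conjugateᴮ 1)) sc≡e

    cofactor-kernel : ∀ {y} → D.InOrbit y → Kernel (N · y)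
    cofactor-kernel {y} y-orbit = orbit-torsion⊆kernel (D.orbit-· N y-orbit)
      (trans (·-assocˡ y s N) (trans (cong (_· y) (sym n≡sN)) (n·x≡e y)))

  -- As `φ a` is `y ⊕ a` with `y` in the kernel, `φ` splits off `φ y` both from `y ⊕ a` and from
  -- `y ⊕ (a ⊕ b)`, so the exponent at `a` also serves at `φ a`.
  displacements-in-kernel⇒coset-preserving :
    (∀ a → Kernel (⊖ a ⊕ φ a)) →
    ∀ a i → PowerFunctionValue φ k a i → PowerFunctionValue φ k (φ a) i
  displacements-in-kernel⇒coset-preserving kernel a i (1≤i , i≤k , φ-a) = 1≤i , i≤k , λ b → begin
    φ (φ a ⊕ b)                   ≡⟨ cong (λ t → φ (t ⊕ b)) φa≡ ⟨
    φ ((y ⊕ a) ⊕ b)               ≡⟨ cong φ (⊕-assoc y a b) ⟩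
    φ (y ⊕ (a ⊕ b))               ≡⟨ kernel a _ ⟩
    φ y ⊕ φ (a ⊕ b)               ≡⟨ cong (φ y ⊕_) (φ-a b) ⟩
    φ y ⊕ (φ a ⊕ iter φ i b)      ≡⟨ ⊕-assoc _ _ _ ⟨
    (φ y ⊕ φ a) ⊕ iter φ i b      ≡⟨ cong (_⊕ iter φ i b) (kernel a a) ⟨
    φ (y ⊕ a) ⊕ iter φ i b        ≡⟨ cong (λ t → φ t ⊕ iter φ i b) φa≡ ⟩
    φ (φ a) ⊕ iter φ i b          ∎
    where
    open ≡-Reasoning
    y = ⊖ a ⊕ φ a
    φa≡ : y ⊕ a ≡ φ a
    φa≡ = trans (⊕-comm y a) (\\-leftDividesˡ a (φ a))

  -- The cofactors `r * q`, `r * p` and `p * q` each take a displacement `y` into the kernel. The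
  -- first two have gcd `r`, which is coprime to the third, so `y` itself lies there.
  coset-preserving-of-three-primes : ∀ {p q r} → Prime p → Prime q → Prime r →
    p ≢ q → q ≢ r → p ≢ r → n ≡ p * q * r →
    ∀ a i → PowerFunctionValue φ k a i → PowerFunctionValue φ k (φ a) i
  coset-preserving-of-three-primes {p} {q} {r} pp pq pr p≢q q≢r p≢r n≡pqr =
    displacements-in-kernel⇒coset-preserving λ a →
      let y = ⊖ a ⊕ φ a
          y-orbit = displacement-orbit a
          J = kernel-ideal y
          r∈J = subst (λ t → Kernel (t · y))
            (trans (sym (c*gcd[m,n]≡gcd[cm,cn] r q p))
              (trans (cong (r *_) (coprime⇒gcd≡1 (distinct pq pp (λ q≡p → p≢q (sym q≡p))))) (*-identityʳ r)))
            (IsIdeal.has-gcd J (r * q) (r * p)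
              (cofactor-kernel pp (trans n≡pqr (trans (*-assoc p q r) (cong (p *_) (*-comm q r))))
                (coprime-* pp pr pq p≢r p≢q) y-orbit)
              (cofactor-kernel pq (trans n≡pqr (trans (cong (_* r) (*-comm p q))
                  (trans (*-assoc q p r) (cong (q *_) (*-comm p r)))))
                (coprime-* pq pr pp q≢r (λ q≡p → p≢q (sym q≡p))) y-orbit))
          r⊥pq = coprime-* pr pp pq (λ r≡p → p≢r (sym r≡p)) (λ r≡q → q≢r (sym r≡q))
      in subst Kernel (⊕-identityʳ y) (IsIdeal.has-1 J r⊥pq r∈J
           (cofactor-kernel pr (trans n≡pqr (*-comm (p * q) r)) r⊥pq y-orbit))
    where
    distinct-∤ : ∀ {s t} → Prime s → Prime t → s ≢ t → ¬ s ∣ t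
    distinct-∤ ps pt s≢t s∣t with prime⇒irreducible pt s∣t
    ... | inj₁ s≡1 = ¬prime[1] (subst Prime s≡1 ps)
    ... | inj₂ s≡t = s≢t s≡t
    distinct : ∀ {s t} → Prime s → Prime t → s ≢ t → Coprime s t
    distinct ps pt s≢t = prime∤⇒coprime ps (distinct-∤ ps pt s≢t)
    coprime-* : ∀ {s t u} → Prime s → Prime t → Prime u → s ≢ t → s ≢ u → Coprime s (t * u)
    coprime-* {s} {t} {u} ps pt pu s≢t s≢u = prime∤⇒coprime ps λ s∣tu → case (euclidsLemma t u ps s∣tu)
      where
      case : s ∣ t ⊎ s ∣ u → ⊥
      case (inj₁ s∣t) = distinct-∤ ps pt s≢t s∣t
      case (inj₂ s∣u) = distinct-∤ ps pu s≢u s∣u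

theorem7p3 : (p q r : ℕ) → Prime p → Prime q → Prime r →
    p ≢ q → q ≢ r → p ≢ r →
    (n : ℕ) .{{_ : NonZero n}} → n ≡ p * q * r →
    (φ : Cyclic.C n → Cyclic.C n) → Cyclic.IsSkewMorphism n φ →
    Cyclic.IsCosetPreserving n φ
theorem7p3 p q r p-prime q-prime r-prime p≢q q≢r p≢r n n≡pqr φ isSkew k isOrder =
  SkewMorphism.coset-preserving-of-three-primes n φ isSkew k isOrder
    p-prime q-prime r-prime p≢q q≢r p≢r n≡pqr
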